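{- Let $G$ be a finite abelian group. Then \[ \mu(G)=\begin{cases}\infty, & |G|\le 8\ \text{ or }\ G\cong C_3^2,\\ 6, & \text{otherwise.}\end{cases} \]
   Context: Groups are written additively; $C_m$ denotes the cyclic group of order $m$, and $C_3^2=C_3\oplus C_3$. For a finite subset $S$ of an abelian group $G$, write $\sigma(S)=\sum_{s\in S}s\in G$. A zero-sum triple partition of $S$ is a decomposition $S=T_1\sqcup\cdots\sqcup T_m$ ($m\ge 0$) into pairwise disjoint subsets with $|T_i|=3$ and $\sigma(T_i)=0$ for every $i$ (for $m=0$ this is the empty partition of the empty set). A finite subset $S\subseteq G$ is admissible if $3\mid |S|$ and $\sigma(S)=0$; it is partitionable if it has a zero-sum triple partition, and non-partitionable otherwise. For a finite abelian group $G$, $\mu(G)$ is the least cardinality of a non-partitionable admissible subset of $G$, with $\mu(G)=\infty$ if no such subset exists. -}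

module Defs where

open import Level using (Level; _⊔_; 0ℓ) renaming (suc to lsuc)
open import Algebra.Bundles using (AbelianGroup)
open import Algebra.Construct.DirectProduct using (abelianGroup)
open import Algebra.Morphism.Structures using (module GroupMorphisms)
open import Algebra.Structures using (IsAbelianGroup)
open import Data.Empty using (⊥-elim)
open import Data.Fin.Base using (Fin; toℕ)
open import Data.Fin.Properties using (toℕ-fromℕ<; toℕ-injective; toℕ<n; toℕ≤n)
open import Data.List.Base using (List; length; foldr)
open import Data.Nat.Base using (ℕ; _+_; _∸_; _≤_; NonZero; >-nonZero⁻¹)
open import Data.Nat.Divisibility using (_∣_)
open import Data.Nat.DivMod using (_%_; _mod_; m%n<n; m<n⇒m%n≡m; n%n≡0; m%n%n≡m%n; %-distribˡ-+)
open import Data.Nat.Properties using (+-assoc; +-comm; ≤-antisym; m∸n+n≡m)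
open import Data.Product.Base using (Σ-syntax; ∃-syntax; _×_; _,_)
open import Function.Bundles using (Inverse; _⇔_)
open import Relation.Binary.PropositionalEquality
  using (_≡_; _≢_; refl; sym; trans; cong; cong₂; isEquivalence; setoid; module ≡-Reasoning)
open import Relation.Nullary using (¬_)
open import Relation.Nullary.Construct.Add.Supremum public
  using (_⁺; [_]) renaming (⊤⁺ to ∞)
import Data.List.Membership.Setoid as Membership
import Data.List.Relation.Binary.Disjoint.Setoid as DisjointLists
import Data.List.Relation.Unary.Unique.Setoid as UniqueLists

private
  variable
    c ℓ c′ ℓ′ : Level

-- Equality on the carrier is a setoid equality, so the order is the number of
-- equivalence classes; `enumeration` is a bijection up to _≈_.
record FiniteAbelianGroup c ℓ : Set (lsuc (c ⊔ ℓ)) where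
  field
    group       : AbelianGroup c ℓ
    order       : ℕ
    enumeration : Inverse (AbelianGroup.setoid group) (setoid (Fin order))

_≅_ : AbelianGroup c ℓ → AbelianGroup c′ ℓ′ → Set (c ⊔ ℓ ⊔ c′ ⊔ ℓ′)
G ≅ H = Σ[ f ∈ (G.Carrier → H.Carrier) ] IsGroupIsomorphism f
  where
  module G = AbelianGroup G
  module H = AbelianGroup H
  open GroupMorphisms G.rawGroup H.rawGroup

module _ (m : ℕ) .{{_ : NonZero m}} where

  private
    infixl 6 _⊕_

    _⊕_ : Fin m → Fin m → Fin m
    x ⊕ y = (toℕ x + toℕ y) mod m

    0# : Fin m
    0# = 0 mod m

    ⊖_ : Fin m → Fin m
    ⊖ x = (m ∸ toℕ x) mod m

    toℕ-mod : ∀ a → toℕ (a mod m) ≡ a % m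
    toℕ-mod a = toℕ-fromℕ< (m%n<n a m)

    toℕ-% : ∀ (x : Fin m) → toℕ x % m ≡ toℕ x
    toℕ-% x = m<n⇒m%n≡m (toℕ<n x)

    mod-cong : ∀ {a b} → a % m ≡ b % m → a mod m ≡ b mod m
    mod-cong {a} {b} eq =
      toℕ-injective (trans (toℕ-mod a) (trans eq (sym (toℕ-mod b))))

    %-absorbˡ : ∀ a b → (a % m + b) % m ≡ (a + b) % m
    %-absorbˡ a b = begin
      (a % m + b) % m          ≡⟨ %-distribˡ-+ (a % m) b m ⟩
      (a % m % m + b % m) % m  ≡⟨ cong (λ z → (z + b % m) % m) (m%n%n≡m%n a m) ⟩
      (a % m + b % m) % m      ≡⟨ %-distribˡ-+ a b m ⟨
      (a + b) % m              ∎
      where open ≡-Reasoning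

    comm : ∀ x y → x ⊕ y ≡ y ⊕ x
    comm x y = cong (_mod m) (+-comm (toℕ x) (toℕ y))

    assoc : ∀ x y z → (x ⊕ y) ⊕ z ≡ x ⊕ (y ⊕ z)
    assoc x y z = mod-cong (begin
      (toℕ (x ⊕ y) + k) % m    ≡⟨ cong (λ w → (w + k) % m) (toℕ-mod (i + j)) ⟩
      ((i + j) % m + k) % m    ≡⟨ %-absorbˡ (i + j) k ⟩
      (i + j + k) % m          ≡⟨ cong (_% m) (trans (+-assoc i j k) (+-comm i (j + k))) ⟩
      (j + k + i) % m          ≡⟨ %-absorbˡ (j + k) i ⟨
      ((j + k) % m + i) % m    ≡⟨ cong (λ w → (w + i) % m) (toℕ-mod (j + k)) ⟨
      (toℕ (y ⊕ z) + i) % m    ≡⟨ cong (_% m) (+-comm (toℕ (y ⊕ z)) i) ⟩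
      (i + toℕ (y ⊕ z)) % m    ∎)
      where
      open ≡-Reasoning
      i = toℕ x
      j = toℕ y
      k = toℕ z

    identityˡ : ∀ x → 0# ⊕ x ≡ x
    identityˡ x = toℕ-injective (begin
      toℕ (0# ⊕ x)              ≡⟨ toℕ-mod (toℕ 0# + toℕ x) ⟩
      (toℕ 0# + toℕ x) % m      ≡⟨ cong (λ w → (w + toℕ x) % m) (toℕ-mod 0) ⟩
      (0 % m + toℕ x) % m       ≡⟨ %-absorbˡ 0 (toℕ x) ⟩
      toℕ x % m                 ≡⟨ toℕ-% x ⟩
      toℕ x                     ∎)
      where open ≡-Reasoning

    inverseˡ : ∀ x → (⊖ x) ⊕ x ≡ 0#
    inverseˡ x = mod-cong (begin
      (toℕ (⊖ x) + toℕ x) % m          ≡⟨ cong (λ w → (w + toℕ x) % m) (toℕ-mod (m ∸ toℕ x)) ⟩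
      ((m ∸ toℕ x) % m + toℕ x) % m    ≡⟨ %-absorbˡ (m ∸ toℕ x) (toℕ x) ⟩
      (m ∸ toℕ x + toℕ x) % m          ≡⟨ cong (_% m) (m∸n+n≡m (toℕ≤n x)) ⟩
      m % m                            ≡⟨ n%n≡0 m ⟩
      0                                ≡⟨ m<n⇒m%n≡m (>-nonZero⁻¹ m) ⟨
      0 % m                            ∎)
      where open ≡-Reasoning

    isAbelianGroup : IsAbelianGroup _≡_ _⊕_ 0# ⊖_
    isAbelianGroup = record
      { isGroup = record
        { isMonoid = record
          { isSemigroup = record
            { isMagma = record
              { isEquivalence = isEquivalence
              ; ∙-cong        = cong₂ _⊕_
              }
            ; assoc = assoc
            }
          ; identity = identityˡ , λ x → trans (comm x 0#) (identityˡ x)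
          }
        ; inverse = inverseˡ , λ x → trans (comm x (⊖ x)) (inverseˡ x)
        ; ⁻¹-cong = cong ⊖_
        }
      ; comm = comm
      }

  C : AbelianGroup 0ℓ 0ℓ
  C = record { isAbelianGroup = isAbelianGroup }

C₃² : AbelianGroup 0ℓ 0ℓ
C₃² = abelianGroup (C 3) (C 3)

module _ (G : AbelianGroup c ℓ) where

  open AbelianGroup G renaming (setoid to ≈-setoid; _∙_ to _+ᴳ_; ε to 0ᴳ) hiding (sym; trans; refl)
  open Membership ≈-setoid using () renaming (_∈_ to _∈ˡ_)
  open DisjointLists ≈-setoid using () renaming (Disjoint to Disjointˡ)
  open UniqueLists ≈-setoid using (Unique)

  -- A finite subset is given by a duplicate-free listing of its elements.
  -- The order of the listing is immaterial to everything defined below.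
  record FiniteSubset : Set (c ⊔ ℓ) where
    field
      elements : List Carrier
      unique   : Unique elements

  open FiniteSubset

  _∈_ : Carrier → FiniteSubset → Set (c ⊔ ℓ)
  x ∈ S = x ∈ˡ elements S

  Disjoint : FiniteSubset → FiniteSubset → Set (c ⊔ ℓ)
  Disjoint S T = Disjointˡ (elements S) (elements T)

  ∣_∣ : FiniteSubset → ℕ
  ∣ S ∣ = length (elements S)

  σ : FiniteSubset → Carrier
  σ S = foldr _+ᴳ_ 0ᴳ (elements S)

  record ZeroSumTriplePartition (S : FiniteSubset) : Set (c ⊔ ℓ) where
    field
      m        : ℕ
      T        : Fin m → FiniteSubset
      union    : ∀ x → x ∈ S ⇔ (∃[ i ] x ∈ T i)
      disjoint : ∀ {i j} → i ≢ j → Disjoint (T i) (T j)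
      triple   : ∀ i → ∣ T i ∣ ≡ 3
      zero-sum : ∀ i → σ (T i) ≈ 0ᴳ

  Admissible : FiniteSubset → Set ℓ
  Admissible S = 3 ∣ ∣ S ∣ × σ S ≈ 0ᴳ

  Partitionable : FiniteSubset → Set (c ⊔ ℓ)
  Partitionable = ZeroSumTriplePartition

  NonPartitionable : FiniteSubset → Set (c ⊔ ℓ)
  NonPartitionable S = ¬ Partitionable S

  -- k is the cardinality of a non-partitionable admissible subset.
  Attained : ℕ → Set (c ⊔ ℓ)
  Attained k = Σ[ S ∈ FiniteSubset ] Admissible S × NonPartitionable S × ∣ S ∣ ≡ k

-- The graph of μ: a minimum over ℕ is not computable from an arbitrary
-- predicate, so "μ(G) = v" is a relation, functional by μ-unique.
μ⟨_⟩≡_ : FiniteAbelianGroup c ℓ → ℕ ⁺ → Set (c ⊔ ℓ)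
μ⟨ G ⟩≡ ∞     = ∀ k → ¬ Attained (FiniteAbelianGroup.group G) k
μ⟨ G ⟩≡ [ k ] = Attained (FiniteAbelianGroup.group G) k
              × (∀ j → Attained (FiniteAbelianGroup.group G) j → k ≤ j)

μ-unique : (G : FiniteAbelianGroup c ℓ) {v w : ℕ ⁺} → μ⟨ G ⟩≡ v → μ⟨ G ⟩≡ w → v ≡ w
μ-unique G {∞}     {∞}     _       _       = refl
μ-unique G {∞}     {[ k ]} p       (q , _) = ⊥-elim (p k q)
μ-unique G {[ k ]} {∞}     (p , _) q       = ⊥-elim (q k p)
μ-unique G {[ k ]} {[ j ]} (p , p≤) (q , q≤) = cong [_] (≤-antisym (p≤ j q) (q≤ k p))

{-# OPTIONS --safe #-}

-- A zero-sum 6-set is non-partitionable iff no three of its elements sum to zero.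
--
-- If S is such a set, fix a ∈ S: the six elements −(a + q), q ∈ S, are distinct, and
-- those lying in S are among −2a, a and the q ∈ S with −2q = a.  As q ↦ −2q maps the
-- six-element S to G, some a ∈ S has at most one such q, so at least three of the
-- elements lie outside S and |G| ≥ 9.  In exponent 3 only a itself can lie in S, so
-- |G| ≥ 11; and the only admissible 9-set of C₃² is the whole group, which reduces to
-- a 6-set by removing any zero-sum triple.
--
-- Conversely let A be a 4-set without zero-sum triple in a proper subgroup H.  For
-- x ∉ H, the set A ∪ {x, −x − Σ A} is a non-partitionable zero-sum set unless
-- 2x + Σ A = 0, which can be avoided by moving x by some u ∈ H with 2u ≠ 0.  If G has
-- an element g of order ≥ 9 there are explicit sets of multiples of g; order 5, 6, 7
-- or 8 gives H = ⟨g⟩.  Otherwise G has exponent 2, 3 or 4, and A = {0, e₁, e₂, e₃} in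
-- exponent 2, A = {0, a, b, a + b} in exponents 3 and 4, with H generated by A.
module Submission where

open import Defs hiding (_∈_; Disjoint; ∣_∣)
open import Algebra.Bundles using (AbelianGroup)
open import Algebra.Morphism.Structures using (module GroupMorphisms)
import Algebra.Properties.AbelianGroup as AbelianGroupProperties
import Algebra.Properties.CommutativeMonoid.Mult as Mult
import Algebra.Solver.CommutativeMonoid as Solver
open import Level using (_⊔_)
open import Data.Empty using (⊥; ⊥-elim)
open import Data.Fin.Base using (Fin; zero; suc; toℕ; fromℕ<; combine)
import Data.Fin.Properties as Fin
open import Data.List.Base
  using (List; []; _∷_; _++_; length; map; filter; foldr; tabulate; applyUpTo; cartesianProductWith)
open import Data.List.Properties using (length-++; length-map; length-tabulate; length-applyUpTo)
import Data.List.Membership.DecSetoid as DecMembership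
import Data.List.Membership.Setoid.Properties as Membership
import Data.List.Relation.Binary.Permutation.Setoid as Permutation
import Data.List.Relation.Binary.Permutation.Setoid.Properties as PermutationProperties
import Data.List.Relation.Binary.Disjoint.Setoid as Disjointness
import Data.List.Relation.Binary.Subset.Setoid as Subset
open import Data.List.Relation.Unary.All as All using (All; []; _∷_)
import Data.List.Relation.Unary.All.Properties as All
open import Data.List.Relation.Unary.AllPairs as AllPairs using (AllPairs; []; _∷_)
import Data.List.Relation.Unary.AllPairs.Properties as AllPairs
open import Data.List.Relation.Unary.Any as Any using (here; there)
import Data.List.Relation.Unary.Unique.Setoid as Uniqueness
import Data.List.Relation.Unary.Unique.Setoid.Properties as Unique
open import Data.Nat.Base using (ℕ; zero; suc; _+_; _*_; _≤_; _<_; z≤n; s≤s; ∣_-_∣; NonZero; _∸_)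
open import Data.Nat.Divisibility using (divides)
open import Data.Nat.DivMod using (_%_; _/_; _mod_; m≡m%n+[m/n]*n; m%n<n)
open import Data.Nat.ListAction using () renaming (sum to ℕ-sum)
import Data.Nat.Properties as ℕ
open import Data.Product.Base using (Σ-syntax; ∃-syntax; ∃₂; _×_; _,_; proj₁; proj₂; uncurry)
open import Data.Sum.Base using (_⊎_; inj₁; inj₂; [_,_]′)
open import Function.Base using (_∘_; case_of_)
open import Function.Definitions using (Congruent)
open import Function.Bundles using (Inverse; mk⇔; module Equivalence)
open import Relation.Binary.Bundles using (DecSetoid)
open import Relation.Binary.Definitions using (Decidable; _Respects_)
open import Relation.Binary.PropositionalEquality as ≡ using (_≡_; _≢_)
import Relation.Binary.Reasoning.Setoid as SetoidReasoning
open import Relation.Nullary using (¬_; Dec; yes; no; contradiction)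
open import Relation.Nullary.Decidable using (map′; _×-dec_; _→-dec_; from-yes; ¬?; decidable-stable)

-- Decidable conditions on coefficients, and explicit coefficients.

-- N k is meant to certify k · g ≉ ε, which turns conditions on multiples of a group
-- element g into decidable conditions on their coefficients.
module Coefficients (N : ℕ → Set) (N? : ∀ k → Dec (N k)) where

  -- Nonvanishing of a multiple does not depend on the sign of its coefficient, so differences enter
  -- as `∣ i - j ∣`. The sum of three of the four numbers is the total minus the fourth, hence the
  -- last condition.
  IsQuadruple : List ℕ → Set
  IsQuadruple is = length is ≡ 4 × AllPairs (λ i j → N ∣ i - j ∣) is × All (λ i → N ∣ ℕ-sum is - i ∣) is

  isQuadruple? : ∀ is → Dec (IsQuadruple is)
  isQuadruple? is =
    length is ℕ.≟ 4 ×-dec AllPairs.allPairs? (λ i j → N? _) is ×-dec All.all? (λ i → N? _) is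

  -- The hypotheses of `quadruple⇒attained` for x = k · g, in the same order: x is new, y = -(x + Σ
  -- as) is new, x and y differ, and no two of the four complete x.
  Extends : List ℕ → ℕ → Set
  Extends is k = All (λ i → N ∣ k - i ∣) is × All (λ i → N (k + (ℕ-sum is + i))) is
               × N (k + (k + ℕ-sum is)) × AllPairs (λ i j → N (k + (i + j))) is

  extends? : ∀ is k → Dec (Extends is k)
  extends? is k = All.all? (λ i → N? _) is ×-dec All.all? (λ i → N? _) is
            ×-dec N? _ ×-dec AllPairs.allPairs? (λ i j → N? _) is

length-cartesianProductWith : ∀ {a b c} {A : Set a} {B : Set b} {C : Set c} (f : A → B → C) xs ys →
                              length (cartesianProductWith f xs ys) ≡ length xs * length ys
length-cartesianProductWith f []       ys = ≡.refl
length-cartesianProductWith f (x ∷ xs) ys = ≡.trans (length-++ (map (f x) ys))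
  (≡.cong₂ _+_ (length-map (f x) ys) (length-cartesianProductWith f xs ys))

-- Turns a bounded number into an offset in `Fin k`, to which a table checked over `Fin k` or a
-- pattern match applies.
interval : ∀ {a n} k → a ≤ n → n < a + k → Σ[ i ∈ Fin k ] a + toℕ i ≡ n
interval {a} {n} k a≤n n<a+k = fromℕ< n∸a<k , ≡.trans (≡.cong (a +_) (Fin.toℕ-fromℕ< n∸a<k)) (ℕ.m+[n∸m]≡n a≤n)
  where
  n∸a<k : n ∸ a < k
  n∸a<k = ℕ.+-cancelˡ-< a _ _ (≡.subst (_< a + k) (≡.sym (ℕ.m+[n∸m]≡n a≤n)) n<a+k)

-- The certificate for an element of exact order m, justified by `%≢0⇒≉ε`.
module Modulo (m : ℕ) .{{_ : NonZero m}} =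
  Coefficients (λ k → k % m ≢ 0) (λ k → ¬? (k % m ℕ.≟ 0))

-- The bound 14 is the largest coefficient that arises when 0, 1, 2, 3 is extended by 4, namely 4 +
-- (4 + 6).
module UpTo14 = Coefficients (λ k → 0 < k × k ≤ 14) (λ k → 0 ℕ.<? k ×-dec k ℕ.≤? 14)

-- A single quadruple that works modulo 5, 6, 7 and 8 alike.
quadruple₅₋₈ : List ℕ
quadruple₅₋₈ = 13 ∷ 14 ∷ 16 ∷ 17 ∷ []

-- Modulo 5, 6, 7, 8 the residues are {1, 2, 3, 4}, {1, 2, 4, 5}, {0, 2, 3, 6}, {0, 1, 5, 6}, and
-- the total 60 becomes 0, 0, 4, 4.
quadruple₅₋₈-valid : ∀ (i : Fin 4) → Modulo.IsQuadruple (5 + toℕ i) quadruple₅₋₈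
quadruple₅₋₈-valid = from-yes (Fin.all? {n = 4} λ i → Modulo.isQuadruple? (5 + toℕ i) quadruple₅₋₈)

-- Four coefficients and a fifth; the sixth is minus their total. Modulo 9 and 10 this gives the
-- symmetric sets {±1, ±2, ±4} and {±2, ±3, ±4}. The default serves 11, 13 and 14.
quadruple₉₋₁₄ : ℕ → List ℕ × ℕ
quadruple₉₋₁₄ 9  = (2 ∷ 7 ∷ 8 ∷ 13 ∷ []) , 14
quadruple₉₋₁₄ 10 = (2 ∷ 7 ∷ 8 ∷ 13 ∷ []) , 14
quadruple₉₋₁₄ 12 = (0 ∷ 1 ∷ 3 ∷ 4 ∷ []) , 6
quadruple₉₋₁₄ _  = (0 ∷ 2 ∷ 7 ∷ 8 ∷ []) , 10

quadruple₉₋₁₄-valid : ∀ (i : Fin 6) → let m = 9 + toℕ i ; is , k = quadruple₉₋₁₄ m in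
                      Modulo.IsQuadruple m is × Modulo.Extends m is k
quadruple₉₋₁₄-valid = from-yes (Fin.all? {n = 6} λ i → let m = 9 + toℕ i ; is , k = quadruple₉₋₁₄ m in
  Modulo.isQuadruple? m is ×-dec Modulo.extends? m is k)

module _ {c ℓ} (𝔾 : FiniteAbelianGroup c ℓ) where

  open FiniteAbelianGroup 𝔾
  open AbelianGroup group hiding (group)
  open AbelianGroupProperties group
  open Inverse enumeration using (to; from; to-cong; strictlyInverseʳ; strictlyInverseˡ; from-cong)
  open FiniteSubset
  private
    module CM = Solver commutativeMonoid
    module ≈-Reasoning = SetoidReasoning setoid

  -- Decidable equality, and duplicate-free lists as sets.

  to-injective : ∀ {x y} → to x ≡ to y → x ≈ y
  to-injective {x} {y} eq =
    trans (sym (strictlyInverseʳ x)) (trans (from-cong eq) (strictlyInverseʳ y))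

  infix 4 _≟_
  _≟_ : Decidable _≈_
  x ≟ y = map′ to-injective to-cong (to x Fin.≟ to y)

  decSetoid : DecSetoid c ℓ
  decSetoid = record { isDecEquivalence = record { isEquivalence = isEquivalence ; _≟_ = _≟_ } }

  open DecMembership decSetoid using (_∈_; _∉_; _∈?_; find)
  open Uniqueness setoid using (Unique)
  open Subset setoid using (_⊆_)
  open Disjointness setoid using (Disjoint)
  open Permutation setoid using (_↭_; ↭-refl; ↭-sym; ↭-trans; prep; swap)
  open PermutationProperties setoid
    using (∈-resp-↭; Unique-resp-↭; xs↭ys⇒|xs|≡|ys|; foldr-commMonoid; ++-identityʳ)

  universe : List Carrier
  universe = tabulate from

  ∈-universe : ∀ x → x ∈ universe
  ∈-universe x = Membership.∈-resp-≈ setoid (strictlyInverseʳ x) (Membership.∈-tabulate⁺ setoid (to x))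

  ∈⇒↭ : ∀ {x xs} → x ∈ xs → ∃[ ys ] xs ↭ x ∷ ys
  ∈⇒↭ {xs = _ ∷ ys} (here x≈y) = ys , prep (sym x≈y) ↭-refl
  ∈⇒↭ {xs = y ∷ _} (there x∈ys) with zs , ys↭x∷zs ← ∈⇒↭ x∈ys =
    y ∷ zs , ↭-trans (prep refl ys↭x∷zs) (swap refl refl ↭-refl)

  -- The entries of `xs` are pulled out of `ys` one by one; since `xs` has no duplicates, none is
  -- asked for twice. The remainder `zs` serves as the complement of `xs` in `ys`.
  ⊆⇒↭ : ∀ {xs ys} → Unique xs → xs ⊆ ys → ∃[ zs ] ys ↭ xs ++ zs
  ⊆⇒↭ {[]}     {ys} _ _ = ys , ↭-refl
  ⊆⇒↭ {x ∷ xs} {ys} (x≉xs ∷ xs!) x∷xs⊆ys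
    with ys′ , ys↭x∷ys′ ← ∈⇒↭ (x∷xs⊆ys (here refl))
    with zs , ys′↭xs++zs ← ⊆⇒↭ xs! (λ y∈xs →
      case ∈-resp-↭ ys↭x∷ys′ (x∷xs⊆ys (there y∈xs)) of λ where
        (here y≈x)    → contradiction (Membership.∈-resp-≈ setoid y≈x y∈xs) (All.All¬⇒¬Any x≉xs)
        (there y∈ys′) → y∈ys′)
    = zs , ↭-trans ys↭x∷ys′ (prep refl ys′↭xs++zs)

  ⊆⇒length≤ : ∀ {xs ys} → Unique xs → xs ⊆ ys → length xs ≤ length ys
  ⊆⇒length≤ {xs} xs! xs⊆ys with zs , ys↭ ← ⊆⇒↭ xs! xs⊆ys =
    ≡.subst (length xs ≤_)
      (≡.sym (≡.trans (xs↭ys⇒|xs|≡|ys| ys↭) (length-++ xs))) (ℕ.m≤m+n _ _)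

  unique⇒length≤order : ∀ {xs} → Unique xs → length xs ≤ order
  unique⇒length≤order xs! =
    ≡.subst (_ ≤_) (length-tabulate from) (⊆⇒length≤ xs! (λ {x} _ → ∈-universe x))

  Unique-++⁻ : ∀ xs {ys} → Unique (xs ++ ys) → Unique xs × Unique ys × Disjoint xs ys
  Unique-++⁻ []       ys! = [] , ys! , λ ()
  Unique-++⁻ (x ∷ xs) (x≉ ∷ xs++ys!)
    with xs! , ys! , xs#ys ← Unique-++⁻ xs xs++ys!
    = All.++⁻ˡ xs x≉ ∷ xs! , ys! , λ where
        (here z≈x , z∈ys)   → All.All¬⇒¬Any (All.++⁻ʳ xs x≉) (Membership.∈-resp-≈ setoid z≈x z∈ys)
        (there z∈xs , z∈ys) → xs#ys (z∈xs , z∈ys)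

  -- Adjoining and removing zero-sum triples.

  sum : List Carrier → Carrier
  sum = foldr _∙_ ε

  sum-++ : ∀ xs ys → sum (xs ++ ys) ≈ sum xs ∙ sum ys
  sum-++ []       ys = sym (identityˡ _)
  sum-++ (x ∷ xs) ys = trans (∙-congˡ (sum-++ xs ys)) (sym (assoc _ _ _))

  -- The listing of `S` stays duplicate-free under the permutation, so `t` is disjoint from `R` and
  -- thereby from all triples inside `R`.
  adjoinTriple : ∀ {S R} t → elements S ↭ t ++ elements R → length t ≡ 3 → sum t ≈ ε →
                 Partitionable group R → Partitionable group S
  adjoinTriple {S} {R} t S↭t++R ∣t∣≡3 Σt≈ε P = record
    { m        = suc m
    ; T        = T′
    ; union    = λ x → mk⇔
        (λ x∈S → case Membership.∈-++⁻ setoid t (∈-resp-↭ S↭t++R x∈S) of λ where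
          (inj₁ x∈t) → zero , x∈t
          (inj₂ x∈R) → let i , x∈Tᵢ = Equivalence.to (union x) x∈R in suc i , x∈Tᵢ)
        (λ where
          (zero  , x∈t)  → ∈-resp-↭ (↭-sym S↭t++R) (Membership.∈-++⁺ˡ setoid x∈t)
          (suc i , x∈Tᵢ) → ∈-resp-↭ (↭-sym S↭t++R) (Membership.∈-++⁺ʳ setoid t (T⊆R x∈Tᵢ)))
    ; disjoint = T′-disjoint
    ; triple   = λ where zero → ∣t∣≡3 ; (suc i) → triple i
    ; zero-sum = λ where zero → Σt≈ε  ; (suc i) → zero-sum i
    }
    where
    open ZeroSumTriplePartition P
    T⊆R : ∀ {i x} → x ∈ elements (T i) → x ∈ elements R
    T⊆R {i} {x} x∈Tᵢ = Equivalence.from (union x) (i , x∈Tᵢ)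
    t++R! = Unique-++⁻ t (Unique-resp-↭ S↭t++R (unique S))
    t#R = proj₂ (proj₂ t++R!)
    t′ : FiniteSubset group
    t′ = record { elements = t ; unique = proj₁ t++R! }
    T′ : Fin (suc m) → FiniteSubset group
    T′ zero    = t′
    T′ (suc i) = T i
    T′-disjoint : ∀ {i j} → i ≢ j → Disjoint (elements (T′ i)) (elements (T′ j))
    T′-disjoint {zero}  {zero}  i≢j               = contradiction ≡.refl i≢j
    T′-disjoint {zero}  {suc j} _ (x∈t , x∈Tⱼ)    = t#R (x∈t , T⊆R x∈Tⱼ)
    T′-disjoint {suc i} {zero}  _ (x∈Tᵢ , x∈t)    = t#R (x∈t , T⊆R x∈Tᵢ)
    T′-disjoint {suc i} {suc j} i≢j               = disjoint (i≢j ∘ ≡.cong suc)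

  partitionable₀ : ∀ S → length (elements S) ≡ 0 → Partitionable group S
  partitionable₀ record { elements = [] } _ = record
    { m = 0 ; T = λ () ; union = λ x → mk⇔ (λ ()) (λ ()) ; disjoint = λ {i} → ⊥-elim (Fin.¬Fin0 i)
    ; triple = λ () ; zero-sum = λ () }

  partitionable₃ : ∀ S → length (elements S) ≡ 3 → sum (elements S) ≈ ε → Partitionable group S
  partitionable₃ S ∣S∣≡3 ΣS≈ε =
    adjoinTriple {S} {∅} (elements S)
      (↭-sym (++-identityʳ (elements S))) ∣S∣≡3 ΣS≈ε (partitionable₀ ∅ ≡.refl)
    where
    ∅ : FiniteSubset group
    ∅ = record { elements = [] ; unique = [] }

  record ZeroSumTriple (xs : List Carrier) : Set (c ⊔ ℓ) where
    constructor zeroSumTriple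
    field
      {p q r} : Carrier
      distinct : Unique (p ∷ q ∷ r ∷ [])
      p+q+r≈ε  : sum (p ∷ q ∷ r ∷ []) ≈ ε
      p∈xs     : p ∈ xs
      q∈xs     : q ∈ xs
      r∈xs     : r ∈ xs

  removeTriple : (S : FiniteSubset group) → sum (elements S) ≈ ε → (t : ZeroSumTriple (elements S)) → let open ZeroSumTriple t in
                 Σ[ R ∈ FiniteSubset group ] elements S ↭ (p ∷ q ∷ r ∷ []) ++ elements R × sum (elements R) ≈ ε
  removeTriple S ΣS≈ε (zeroSumTriple {p} {q} {r} pqr! Σ≈ε p∈S q∈S r∈S)
    with zs , S↭pqr++zs ← ⊆⇒↭ {ys = elements S} pqr! (λ where
      (here x≈p)                 → Membership.∈-resp-≈ setoid (sym x≈p) p∈S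
      (there (here x≈q))         → Membership.∈-resp-≈ setoid (sym x≈q) q∈S
      (there (there (here x≈r))) → Membership.∈-resp-≈ setoid (sym x≈r) r∈S)
    = record { elements = zs ; unique = proj₁ (proj₂ (Unique-++⁻ pqr (Unique-resp-↭ S↭pqr++zs (unique S)))) }
    , S↭pqr++zs
    , (begin
        sum zs             ≈⟨ identityˡ _ ⟨
        ε ∙ sum zs         ≈⟨ ∙-congʳ Σ≈ε ⟨
        sum pqr ∙ sum zs   ≈⟨ sum-++ pqr zs ⟨
        sum (pqr ++ zs)    ≈⟨ foldr-commMonoid isCommutativeMonoid S↭pqr++zs ⟨
        sum (elements S)   ≈⟨ ΣS≈ε ⟩
        ε                  ∎)
    where
    open ≈-Reasoning
    pqr = p ∷ q ∷ r ∷ []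

  -- The double negation accommodates a rest that is known to be partitionable only in this form:
  -- for six elements the argument refutes `TripleFree` and exhibits no triple.
  removeTriple⇒partitionable :
    ∀ {n} (S : FiniteSubset group) → length (elements S) ≡ 3 + n → sum (elements S) ≈ ε → ZeroSumTriple (elements S) →
    (∀ (R : FiniteSubset group) → length (elements R) ≡ n → sum (elements R) ≈ ε → ¬ NonPartitionable group R) →
    ¬ NonPartitionable group S
  removeTriple⇒partitionable S ∣S∣≡ ΣS≈ε t rest ¬P
    with R , S↭ , ΣR≈ε ← removeTriple S ΣS≈ε t
    = rest R (ℕ.+-cancelˡ-≡ 3 _ _ (≡.trans (≡.sym (xs↭ys⇒|xs|≡|ys| S↭)) ∣S∣≡)) ΣR≈ε λ P →
      ¬P (adjoinTriple {S} {R} (p ∷ q ∷ r ∷ []) S↭ ≡.refl p+q+r≈ε P)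
    where open ZeroSumTriple t

  -- Fibres of a self-map over a finite set.

  twoDistinct : ∀ {xs} → Unique xs → ¬ length xs ≤ 1 → ∃₂ λ x y → ¬ x ≈ y × x ∈ xs × y ∈ xs
  twoDistinct {[]}         _               1≱ = contradiction z≤n 1≱
  twoDistinct {_ ∷ []}     _               1≱ = contradiction (s≤s z≤n) 1≱
  twoDistinct {x ∷ y ∷ _} ((x≉y ∷ _) ∷ _) _  = x , y , x≉y , here refl , there (here refl)

  fibre : (Carrier → Carrier) → List Carrier → Carrier → List Carrier
  fibre f xs a = filter (λ q → f q ≟ a) xs

  module _ {f : Carrier → Carrier} (f-cong : Congruent _≈_ _≈_ f) {xs : List Carrier} where

    private
      f⁻¹-resp : ∀ {a} → (λ q → f q ≈ a) Respects _≈_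
      f⁻¹-resp q≈r fq≈a = trans (f-cong (sym q≈r)) fq≈a

    ∈-fibre⁺ : ∀ {a q} → q ∈ xs → f q ≈ a → q ∈ fibre f xs a
    ∈-fibre⁺ = Membership.∈-filter⁺ setoid _ f⁻¹-resp

    ∈-fibre⁻ : ∀ {a q} → q ∈ fibre f xs a → q ∈ xs × f q ≈ a
    ∈-fibre⁻ = Membership.∈-filter⁻ setoid _ f⁻¹-resp

    -- Otherwise f would still map onto xs after one of two points of a fibre is
    -- deleted from its domain xs.
    ∃-smallFibre : Unique xs → 0 < length xs → ∃[ a ] a ∈ xs × length (fibre f xs a) ≤ 1
    ∃-smallFibre xs! 0<∣xs∣ with Any.any? (λ a → length (fibre f xs a) ℕ.≤? 1) xs
    ... | yes small = find small
    ... | no ¬small = ⊥-elim (go xs! 0<∣xs∣ fibres)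
      where
      Double : Carrier → Set _
      Double a = ∃₂ λ q r → ¬ q ≈ r × q ∈ xs × r ∈ xs × f q ≈ a × f r ≈ a

      fibres : All Double xs
      fibres = All.map (λ {a} large →
        let q , r , q≉r , q∈ , r∈ = twoDistinct (Unique.filter⁺ setoid _ xs!) large
            q∈xs , fq≈a = ∈-fibre⁻ q∈
            r∈xs , fr≈a = ∈-fibre⁻ r∈
        in q , r , q≉r , q∈xs , r∈xs , fq≈a , fr≈a) (All.¬Any⇒All¬ xs ¬small)

      Double-resp : Double Respects _≈_
      Double-resp a≈b (q , r , q≉r , q∈ , r∈ , fq≈a , fr≈a) =
        q , r , q≉r , q∈ , r∈ , trans fq≈a a≈b , trans fr≈a a≈b

      go : Unique xs → 0 < length xs → All Double xs → ⊥
      go xs! _ D@((q , r , q≉r , q∈xs , r∈xs , fq≈a , fr≈a) ∷ _)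
        with ys , xs↭r∷ys ← ∈⇒↭ r∈xs
        = ℕ.<⇒≱ (ℕ.≤-reflexive (≡.sym (xs↭ys⇒|xs|≡|ys| xs↭r∷ys)))
            (≡.subst (length xs ≤_) (length-map f ys) (⊆⇒length≤ xs! covered))
        where
        skip-r : ∀ {s} → s ∈ xs → ¬ s ≈ r → s ∈ ys
        skip-r s∈xs s≉r = case ∈-resp-↭ xs↭r∷ys s∈xs of λ where
          (here s≈r)   → contradiction s≈r s≉r
          (there s∈ys) → s∈ys
        image : ∀ {s b} → f s ≈ b → s ∈ ys → b ∈ map f ys
        image fs≈b s∈ys = Membership.∈-resp-≈ setoid fs≈b (Membership.∈-map⁺ setoid setoid f-cong s∈ys)
        covered : xs ⊆ map f ys
        covered b∈xs with s , _ , _ , s∈xs , _ , fs≈b , _ ← All.lookupₛ setoid Double-resp D b∈xs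
          with s ≟ r
        ... | no s≉r  = image fs≈b (skip-r s∈xs s≉r)
        -- The preimage is the deleted point `r`; the kept point `q` has the same image.
        ... | yes s≈r = image (trans fq≈a (trans (sym fr≈a) (trans (f-cong (sym s≈r)) fs≈b))) (skip-r q∈xs q≉r)

  -- Triple-free six-element sets force a large group.

  third : Carrier → Carrier → Carrier
  third a q = (a ∙ q) ⁻¹

  third-sum : ∀ a q → sum (a ∷ q ∷ third a q ∷ []) ≈ ε
  third-sum a q = trans (CM.solve 3 (λ a q t → a CM.⊕ (q CM.⊕ (t CM.⊕ CM.id)) CM.⊜ (a CM.⊕ q) CM.⊕ t) refl a q _)
                        (inverseʳ (a ∙ q))

  third-injective : ∀ a {q r} → third a q ≈ third a r → q ≈ r
  third-injective a eq = ∙-cancelˡ a _ _ (⁻¹-injective eq)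

  -- The |xs| distinct elements third a q miss xs up to the elements of ys.
  length≤complement : ∀ {xs ys} a → Unique xs →
                      (∀ {q} → q ∈ xs → third a q ∈ xs → third a q ∈ ys) →
                      length xs + length xs ≤ order + length ys
  length≤complement {xs} {ys} a xs! inside
    with zs , universe↭xs++zs ← ⊆⇒↭ {ys = universe} xs! (λ _ → ∈-universe _)
    = ℕ.≤-trans (ℕ.+-monoʳ-≤ (length xs) ∣xs∣≤) (ℕ.≤-reflexive (begin
        length xs + (length zs + length ys)  ≡⟨ ℕ.+-assoc (length xs) _ _ ⟨
        length xs + length zs + length ys    ≡⟨ ≡.cong (_+ length ys) (length-++ xs) ⟨
        length (xs ++ zs) + length ys        ≡⟨ ≡.cong (_+ length ys) (xs↭ys⇒|xs|≡|ys| universe↭xs++zs) ⟨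
        length universe + length ys          ≡⟨ ≡.cong (_+ length ys) (length-tabulate from) ⟩
        order + length ys                    ∎))
    where
    open ≡.≡-Reasoning
    thirds⊆ : map (third a) xs ⊆ zs ++ ys
    thirds⊆ t∈ with q , q∈xs , t≈third ← Membership.∈-map⁻ setoid setoid t∈
      with Membership.∈-++⁻ setoid xs (∈-resp-↭ universe↭xs++zs (∈-universe (third a q)))
    ... | inj₁ third∈xs = Membership.∈-resp-≈ setoid (sym t≈third) (Membership.∈-++⁺ʳ setoid zs (inside q∈xs third∈xs))
    ... | inj₂ third∈zs = Membership.∈-resp-≈ setoid (sym t≈third) (Membership.∈-++⁺ˡ setoid third∈zs)
    ∣xs∣≤ : length xs ≤ length zs + length ys
    ∣xs∣≤ = ≡.subst₂ _≤_ (length-map (third a) xs) (length-++ zs)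
      (⊆⇒length≤ (Unique.map⁺ setoid setoid (third-injective a) xs!) thirds⊆)

  TripleFree : List Carrier → Set (c ⊔ ℓ)
  TripleFree xs = ¬ ZeroSumTriple xs

  third∈⇒degenerate : ∀ {xs a q} → TripleFree xs → a ∈ xs → q ∈ xs → third a q ∈ xs →
                      q ≈ a ⊎ third a q ≈ a ⊎ third a q ≈ q
  third∈⇒degenerate {a = a} {q} free a∈ q∈ t∈ with q ≟ a | third a q ≟ a | third a q ≟ q
  ... | yes q≈a | _       | _       = inj₁ q≈a
  ... | no _    | yes t≈a | _       = inj₂ (inj₁ t≈a)
  ... | no _    | no _    | yes t≈q = inj₂ (inj₂ t≈q)
  ... | no q≉a  | no t≉a  | no t≉q  = contradiction
    (zeroSumTriple ((q≉a ∘ sym ∷ t≉a ∘ sym ∷ []) ∷ (t≉q ∘ sym ∷ []) ∷ [] ∷ []) (third-sum a q) a∈ q∈ t∈) free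

  -- If `third a q` coincides with `q`, then a = -2q. Such q thus lie in the fibre of this map over
  -- a, which `∃-smallFibre` keeps small for a suitable a.
  minusDouble : Carrier → Carrier
  minusDouble q = (q ∙ q) ⁻¹

  minusDouble-cong : Congruent _≈_ _≈_ minusDouble
  minusDouble-cong q≈r = ⁻¹-cong (∙-cong q≈r q≈r)

  third≈q⇒minusDouble≈a : ∀ {a q} → third a q ≈ q → minusDouble q ≈ a
  third≈q⇒minusDouble≈a {a} {q} t≈q = sym (inverseˡ-unique a (q ∙ q) (begin
    a ∙ (q ∙ q)                  ≈⟨ ∙-congˡ (∙-congˡ (trans (sym t≈q) (sym (identityʳ _)))) ⟩
    a ∙ (q ∙ (third a q ∙ ε))    ≈⟨ third-sum a q ⟩
    ε                            ∎))
    where open ≈-Reasoning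

  -- For a ∈ xs with at most one q ∈ xs such that a + 2q = 0, the only elements
  -- third a q that can lie in xs are −2a, a and that q.
  tripleFree⇒order>8 : ∀ {xs} → Unique xs → length xs ≡ 6 → TripleFree xs → 8 < order
  tripleFree⇒order>8 {xs} xs! ∣xs∣≡6 free
    with a , a∈xs , ∣H∣≤1 ← ∃-smallFibre minusDouble-cong {xs} xs!
                              (≡.subst (0 <_) (≡.sym ∣xs∣≡6) (s≤s z≤n))
    -- The count reads 6 + 6 ≤ |G| + 3.
    = ℕ.+-cancelʳ-≤ 3 9 order (≡.subst (_≤ order + 3) (≡.cong₂ _+_ ∣xs∣≡6 ∣xs∣≡6) (ℕ.≤-trans
        (length≤complement {ys = third a a ∷ a ∷ fibre minusDouble xs a} a xs! inside)
        (ℕ.+-monoʳ-≤ order (s≤s (s≤s ∣H∣≤1)))))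
    where
    inside : ∀ {q} → q ∈ xs → third a q ∈ xs → third a q ∈ third a a ∷ a ∷ fibre minusDouble xs a
    inside q∈ t∈ with third∈⇒degenerate free a∈xs q∈ t∈
    ... | inj₁ q≈a        = here (⁻¹-cong (∙-congˡ q≈a))
    ... | inj₂ (inj₁ t≈a) = there (here t≈a)
    ... | inj₂ (inj₂ t≈q) = there (there (∈-fibre⁺ minusDouble-cong t∈
      (trans (minusDouble-cong t≈q) (third≈q⇒minusDouble≈a t≈q))))

  Exponent3 : Set _
  Exponent3 = ∀ x → x ∙ (x ∙ x) ≈ ε

  exponent3⇒minusDouble≈id : Exponent3 → ∀ x → minusDouble x ≈ x
  exponent3⇒minusDouble≈id 3x≈ε x = sym (inverseˡ-unique x (x ∙ x) (3x≈ε x))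

  -- In exponent 3 one has -2q = q, so in every degenerate case `third a q` equals a, and at most
  -- one of the six elements lies in the set. The count 6 + 6 ≤ |G| + 1 is then weakened to |G| ≥
  -- 10.
  tripleFree⇒order>9 : Exponent3 → ∀ {xs} → Unique xs → length xs ≡ 6 → TripleFree xs → 9 < order
  tripleFree⇒order>9 3x≈ε {a ∷ xs} xs! ∣xs∣≡6 free =
    ℕ.+-cancelʳ-≤ 2 10 order (ℕ.≤-trans
      (≡.subst (_≤ order + 1) (≡.cong₂ _+_ ∣xs∣≡6 ∣xs∣≡6) (length≤complement {ys = a ∷ []} a xs! inside))
      (ℕ.+-monoʳ-≤ order (s≤s z≤n)))
    where
    inside : ∀ {q} → q ∈ a ∷ xs → third a q ∈ a ∷ xs → third a q ∈ a ∷ []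
    inside {q} q∈ t∈ with third∈⇒degenerate free (here refl) q∈ t∈
    ... | inj₁ q≈a        = here (trans (⁻¹-cong (∙-congˡ q≈a)) (exponent3⇒minusDouble≈id 3x≈ε a))
    ... | inj₂ (inj₁ t≈a) = here t≈a
    ... | inj₂ (inj₂ t≈q) = here (trans t≈q (trans (sym (exponent3⇒minusDouble≈id 3x≈ε q)) (third≈q⇒minusDouble≈a t≈q)))

  -- The lower bound 6, and the groups with infinite μ.

  attained⇒6≤ : ∀ j → Attained group j → 6 ≤ j
  attained⇒6≤ _ (S , (divides 0 ∣S∣≡ , ΣS≈ε) , ¬P , _) = ⊥-elim (¬P (partitionable₀ S ∣S∣≡))
  attained⇒6≤ _ (S , (divides 1 ∣S∣≡ , ΣS≈ε) , ¬P , _) = ⊥-elim (¬P (partitionable₃ S ∣S∣≡ ΣS≈ε))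
  attained⇒6≤ _ (S , (divides (suc (suc q)) ∣S∣≡ , _) , _ , ≡.refl) =
    ≡.subst (6 ≤_) (≡.sym ∣S∣≡) (ℕ.m≤m+n 6 (q * 3))

  -- Removing a zero-sum triple leaves three elements with sum zero, which form a triple themselves.
  -- A non-partitionable `S` is therefore triple-free, against the bounds on the order.
  6⇒¬¬partitionable : (order ≤ 8) ⊎ (order ≤ 9 × Exponent3) →
    ∀ S → length (elements S) ≡ 6 → sum (elements S) ≈ ε → ¬ NonPartitionable group S
  6⇒¬¬partitionable small S ∣S∣≡6 ΣS≈ε ¬P = contradiction free ¬free
    where
    free : TripleFree (elements S)
    free t = removeTriple⇒partitionable S ∣S∣≡6 ΣS≈ε t
      (λ R ∣R∣≡3 ΣR≈ε ¬PR → ¬PR (partitionable₃ R ∣R∣≡3 ΣR≈ε)) ¬P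
    ¬free : ¬ TripleFree (elements S)
    ¬free free = [ ℕ.<⇒≱ (tripleFree⇒order>8 (unique S) ∣S∣≡6 free)
                 , (λ (≤9 , 3x≈ε) → ℕ.<⇒≱ (tripleFree⇒order>9 3x≈ε (unique S) ∣S∣≡6 free) ≤9) ]′ small

  -- For x ≠ y take x, y and -(x + y). They are distinct, since -(x + y) = x would give y = -2x = x,
  -- and likewise for y; the third one is listed because the list exhausts the group.
  full⇒zeroSumTriple : Exponent3 → ∀ {xs} → Unique xs → order ≤ length xs → 1 < length xs → ZeroSumTriple xs
  full⇒zeroSumTriple _ {_ ∷ []} _ _ (s≤s ())
  full⇒zeroSumTriple 3x≈ε {xs@(x ∷ y ∷ _)} xs!@((x≉y ∷ _) ∷ _) full _ =
    zeroSumTriple ((x≉y ∷ x≉t ∷ []) ∷ (y≉t ∷ []) ∷ [] ∷ []) (third-sum x y)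
      (here refl) (there (here refl)) (everything (third x y))
    where
    everything : ∀ z → z ∈ xs
    everything z with z ∈? xs
    ... | yes z∈xs = z∈xs
    ... | no z∉xs = contradiction (unique⇒length≤order (All.¬Any⇒All¬ xs z∉xs ∷ xs!)) (ℕ.<⇒≱ (s≤s full))
    y≉t : ¬ y ≈ third x y
    y≉t y≈t = x≉y (trans (sym (third≈q⇒minusDouble≈a (sym y≈t))) (exponent3⇒minusDouble≈id 3x≈ε y))
    x≉t : ¬ x ≈ third x y
    x≉t x≈t = x≉y (sym (trans (sym (third≈q⇒minusDouble≈a {y} {x} (trans (⁻¹-cong (comm y x)) (sym x≈t)))) (exponent3⇒minusDouble≈id 3x≈ε x)))

  -- The cases are |S| = 0, 3, 6 and |S| ≥ 9. The last contradicts |G| ≤ 8; for |G| ≤ 9 it forces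
  -- `S` to be the whole group with 9 elements, and one removed triple leads back to 6.
  small⇒μ≡∞ : (order ≤ 8) ⊎ (order ≤ 9 × Exponent3) → μ⟨ 𝔾 ⟩≡ ∞
  small⇒μ≡∞ small _ (S , (divides 0 ∣S∣≡ , ΣS≈ε) , ¬P , _) = ¬P (partitionable₀ S ∣S∣≡)
  small⇒μ≡∞ small _ (S , (divides 1 ∣S∣≡ , ΣS≈ε) , ¬P , _) = ¬P (partitionable₃ S ∣S∣≡ ΣS≈ε)
  small⇒μ≡∞ small _ (S , (divides 2 ∣S∣≡ , ΣS≈ε) , ¬P , _) = 6⇒¬¬partitionable small S ∣S∣≡ ΣS≈ε ¬P
  small⇒μ≡∞ small _ (S , (divides (suc (suc (suc q))) ∣S∣≡ , ΣS≈ε) , ¬P , _) with small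
  ... | inj₁ ≤8 = contradiction (ℕ.≤-trans 9≤order ≤8) (ℕ.<⇒≱ ℕ.≤-refl)
    where 9≤order = ℕ.≤-trans (≡.subst (9 ≤_) (≡.sym ∣S∣≡) (ℕ.m≤m+n 9 (q * 3))) (unique⇒length≤order (unique S))
  ... | inj₂ (≤9 , 3x≈ε) = removeTriple⇒partitionable S
      (ℕ.≤-antisym (ℕ.≤-trans (unique⇒length≤order (unique S)) ≤9) 9≤∣S∣) ΣS≈ε
      (full⇒zeroSumTriple 3x≈ε (unique S) (ℕ.≤-trans ≤9 9≤∣S∣) (ℕ.≤-trans (s≤s (s≤s z≤n)) 9≤∣S∣))
      (6⇒¬¬partitionable small) ¬P
    where
    9≤∣S∣ : 9 ≤ length (elements S)
    9≤∣S∣ = ≡.subst (9 ≤_) (≡.sym ∣S∣≡) (ℕ.m≤m+n 9 (q * 3))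

  -- Six-element sets built from a quadruple.

  Completes : Carrier → Carrier → Carrier → Set ℓ
  Completes x q r = x ∙ (q ∙ r) ≈ ε

  Completes-comm : ∀ {x q r} → Completes x q r → Completes x r q
  Completes-comm = trans (∙-congˡ (comm _ _))

  -- `AllPairs` covers each pair in list order only; the symmetry of `Completes` supplies the other
  -- order.
  unpaired : ∀ {x xs q r} → AllPairs (λ q r → ¬ Completes x q r) xs →
             q ∈ xs → r ∈ xs → ¬ q ≈ r → ¬ Completes x q r
  unpaired (_ ∷ _) (here q≈y) (here r≈y) q≉r _ = q≉r (trans q≈y (sym r≈y))
  unpaired (y¬ ∷ _) (here q≈y) (there r∈) _ xqr =
    All.lookupₛ setoid (λ r≈s ¬c c → ¬c (trans (∙-congˡ (∙-congˡ r≈s)) c)) y¬ r∈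
      (trans (∙-congˡ (∙-congʳ (sym q≈y))) xqr)
  unpaired pairs@(_ ∷ _) (there q∈) (here r≈y) q≉r xqr =
    unpaired pairs (here r≈y) (there q∈) (q≉r ∘ sym) (Completes-comm xqr)
  unpaired (_ ∷ pairs) (there q∈) (there r∈) q≉r xqr = unpaired pairs q∈ r∈ q≉r xqr

  -- One element decides: in a partition, the triple containing x would consist of x and two further
  -- distinct elements that complete it.
  unpaired⇒nonPartitionable : ∀ {x xs} (x∷xs! : Unique (x ∷ xs)) → AllPairs (λ q r → ¬ Completes x q r) xs →
                              NonPartitionable group (record { elements = x ∷ xs ; unique = x∷xs! })
  unpaired⇒nonPartitionable {x} {xs} x∷xs! pairs P
    with i , x∈Tᵢ ← Equivalence.to (ZeroSumTriplePartition.union P x) (here refl)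
    = go (unique (T i)) (triple i) (zero-sum i) x∈Tᵢ (λ {y} y∈Tᵢ → Equivalence.from (union y) (i , y∈Tᵢ))
    where
    open ZeroSumTriplePartition P
    tail : ∀ {q} → q ∈ x ∷ xs → ¬ x ≈ q → q ∈ xs
    tail (here q≈x)  x≉q = contradiction (sym q≈x) x≉q
    tail (there q∈)  _   = q∈
    clash : ∀ {q r} → q ∈ x ∷ xs → r ∈ x ∷ xs → ¬ x ≈ q → ¬ x ≈ r → ¬ q ≈ r → ¬ Completes x q r
    clash q∈ r∈ x≉q x≉r = unpaired pairs (tail q∈ x≉q) (tail r∈ x≉r)
    go : ∀ {t} → Unique t → length t ≡ 3 → sum t ≈ ε → x ∈ t → t ⊆ x ∷ xs → ⊥
    go {p ∷ q ∷ r ∷ []} ((p≉q ∷ p≉r ∷ []) ∷ (q≉r ∷ []) ∷ [] ∷ []) _ Σt≈ε x∈t t⊆ = case x∈t of λ where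
        (here x≈p) → clash q∈ r∈ (p≉q ∘ trans (sym x≈p)) (p≉r ∘ trans (sym x≈p)) q≉r
          (trans (∙-congʳ x≈p) pqr)
        (there (here x≈q)) → clash p∈ r∈ (p≉q ∘ sym ∘ trans (sym x≈q)) (q≉r ∘ trans (sym x≈q)) p≉r
          (trans (∙-congʳ x≈q) (trans (CM.solve 3 (λ p q r → q CM.⊕ (p CM.⊕ r) CM.⊜ p CM.⊕ (q CM.⊕ r)) refl p q r) pqr))
        (there (there (here x≈r))) → clash p∈ q∈ (p≉r ∘ sym ∘ trans (sym x≈r)) (q≉r ∘ sym ∘ trans (sym x≈r)) p≉q
          (trans (∙-congʳ x≈r) (trans (CM.solve 3 (λ p q r → r CM.⊕ (p CM.⊕ q) CM.⊜ p CM.⊕ (q CM.⊕ r)) refl p q r) pqr))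
      where
      p∈ = t⊆ (here refl)
      q∈ = t⊆ (there (here refl))
      r∈ = t⊆ (there (there (here refl)))
      pqr : p ∙ (q ∙ r) ≈ ε
      pqr = trans (∙-congˡ (∙-congˡ (sym (identityʳ r)))) Σt≈ε

  -- sum as ∉ as says that no three elements of as sum to zero.
  record Quadruple : Set (c ⊔ ℓ) where
    field
      as      : List Carrier
      ∣as∣≡4  : length as ≡ 4
      as!     : Unique as
      Σas∉as  : All (λ a → ¬ sum as ≈ a) as

  -- The sixth element is y = −(x + Σ as).
  quadruple⇒attained : (A : Quadruple) → let open Quadruple A in
    ∀ x → All (λ a → ¬ x ≈ a) as → All (λ a → ¬ x ∙ (sum as ∙ a) ≈ ε) as → ¬ x ∙ (x ∙ sum as) ≈ ε →
    AllPairs (λ q r → ¬ Completes x q r) as → Attained group 6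
  quadruple⇒attained A x x∉as y∉as x≉y pairs =
      record { elements = x ∷ y ∷ as ; unique = S! }
    , (divides 2 (≡.cong (2 +_) ∣as∣≡4) , ΣS≈ε)
    , unpaired⇒nonPartitionable S! (All.map y-pairs Σas∉as ∷ pairs)
    , ≡.cong (2 +_) ∣as∣≡4
    where
    open Quadruple A
    open ≈-Reasoning
    y = (x ∙ sum as) ⁻¹
    ΣS≈ε : x ∙ (y ∙ sum as) ≈ ε
    ΣS≈ε = trans (CM.solve 3 (λ x y s → x CM.⊕ (y CM.⊕ s) CM.⊜ (x CM.⊕ s) CM.⊕ y) refl x y (sum as))
                 (inverseʳ (x ∙ sum as))
    -- As x + y = -Σ as, the triple x, y, a has sum zero only if a = Σ as.
    y-pairs : ∀ {a} → ¬ sum as ≈ a → ¬ Completes x y a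
    y-pairs Σ≉a xya = Σ≉a (∙-cancelˡ y _ _ (∙-cancelˡ x _ _ (trans ΣS≈ε (sym xya))))
    y≈⇒ : ∀ {z} → y ≈ z → x ∙ (sum as ∙ z) ≈ ε
    y≈⇒ {z} y≈z = begin
      x ∙ (sum as ∙ z)  ≈⟨ ∙-congˡ (comm _ _) ⟩
      x ∙ (z ∙ sum as)  ≈⟨ ∙-congˡ (∙-congʳ y≈z) ⟨
      x ∙ (y ∙ sum as)  ≈⟨ ΣS≈ε ⟩
      ε                 ∎
    S! : Unique (x ∷ y ∷ as)
    S! = ((λ x≈y → x≉y (trans (∙-congˡ (comm _ _)) (y≈⇒ (sym x≈y)))) ∷ x∉as)
       ∷ All.map (λ ¬c y≈a → ¬c (y≈⇒ y≈a)) y∉as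
       ∷ as!

  -- Multiples of a single element.

  open Mult commutativeMonoid using (×-homo-+; ×-assocˡ; ×-congʳ; ×-congˡ; ×-homo-1; ×-distrib-+)
    renaming (_×_ to infixr 8 _·_)

  ·-ε : ∀ n → n · ε ≈ ε
  ·-ε zero    = refl
  ·-ε (suc n) = trans (identityˡ _) (·-ε n)

  ·-% : ∀ {g m} .{{_ : NonZero m}} → m · g ≈ ε → ∀ k → k · g ≈ (k % m) · g
  ·-% {g} {m} mg≈ε k = begin
    k · g                                ≈⟨ ×-congˡ (m≡m%n+[m/n]*n k m) ⟩
    (k % m + k / m * m) · g              ≈⟨ ×-homo-+ g (k % m) _ ⟩
    (k % m) · g ∙ (k / m * m) · g        ≈⟨ ∙-congˡ (×-assocˡ g (k / m) m) ⟨
    (k % m) · g ∙ (k / m) · m · g        ≈⟨ ∙-congˡ (trans (×-congʳ (k / m) mg≈ε) (·-ε (k / m))) ⟩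
    (k % m) · g ∙ ε                      ≈⟨ identityʳ _ ⟩
    (k % m) · g                          ∎
    where open ≈-Reasoning

  module Multiples {N : ℕ → Set} (N? : ∀ k → Dec (N k)) {g : Carrier} (N⇒≉ε : ∀ {k} → N k → ¬ k · g ≈ ε) where

    open Coefficients N N?

    multiples : List ℕ → List Carrier
    multiples = map (_· g)

    sum-multiples : ∀ is → sum (multiples is) ≈ ℕ-sum is · g
    sum-multiples []       = refl
    sum-multiples (i ∷ is) = trans (∙-congˡ (sum-multiples is)) (sym (×-homo-+ g i _))

    -- Cancelling one `g` on both sides matches the recursion of `∣_-_∣`.
    ∣-∣⇒≉ : ∀ i j → N ∣ i - j ∣ → ¬ i · g ≈ j · g
    ∣-∣⇒≉ zero    j       = λ Nj → N⇒≉ε Nj ∘ sym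
    ∣-∣⇒≉ (suc i) zero    = N⇒≉ε
    ∣-∣⇒≉ (suc i) (suc j) = λ Nd → ∣-∣⇒≉ i j Nd ∘ ∙-cancelˡ g _ _

    quadruple : ∀ {is} → IsQuadruple is → Quadruple
    quadruple {is} (∣is∣≡4 , is! , Σ∉) = record
      { as     = multiples is
      ; ∣as∣≡4 = ≡.trans (length-map _ is) ∣is∣≡4
      ; as!    = AllPairs.map⁺ (AllPairs.map (λ {i} {j} → ∣-∣⇒≉ i j) is!)
      ; Σas∉as = All.map⁺ (All.map (λ {i} Nd eq → ∣-∣⇒≉ (ℕ-sum is) i Nd (trans (sym (sum-multiples is)) eq)) Σ∉)
      }

    ·-+₃ : ∀ i j k → i · g ∙ (j · g ∙ k · g) ≈ (i + (j + k)) · g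
    ·-+₃ i j k = sym (trans (×-homo-+ g i _) (∙-congˡ (×-homo-+ g j k)))

    attained : ∀ is k → IsQuadruple is → Extends is k → Attained group 6
    attained is k q (k∉ , y∉ , k≉y , pairs) = quadruple⇒attained (quadruple q) (k · g)
      (All.map⁺ (All.map (∣-∣⇒≉ k _) k∉))
      (All.map⁺ (All.map (λ n eq → N⇒≉ε n (trans (sym (·-+₃ k (ℕ-sum is) _))
        (trans (∙-congˡ (∙-congʳ (sym (sum-multiples is)))) eq))) y∉))
      (λ eq → N⇒≉ε k≉y (trans (sym (·-+₃ k k _)) (trans (∙-congˡ (∙-congˡ (sym (sum-multiples is)))) eq)))
      (AllPairs.map⁺ (AllPairs.map (λ {i} {j} n eq → N⇒≉ε n (trans (sym (·-+₃ k i j)) eq)) pairs))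

  -- The first vanishing positive multiple gives the order of g. The search is cut off at n because
  -- small coefficients suffice for elements of larger order.
  ∃-firstVanishing : ∀ g n → (∀ k → 0 < k → k ≤ n → ¬ k · g ≈ ε) ⊎
    ∃[ m ] 0 < m × m ≤ n × m · g ≈ ε × (∀ k → 0 < k → k < m → ¬ k · g ≈ ε)
  ∃-firstVanishing g zero = inj₁ λ k 0<k k≤0 → contradiction k≤0 (ℕ.<⇒≱ 0<k)
  ∃-firstVanishing g (suc n) with ∃-firstVanishing g n
  ... | inj₂ (m , 0<m , m≤n , first) = inj₂ (m , 0<m , ℕ.m≤n⇒m≤1+n m≤n , first)
  ... | inj₁ none with suc n · g ≟ ε
  ...   | yes eq = inj₂ (suc n , s≤s z≤n , ℕ.≤-refl , eq , λ k 0<k k<1+n → none k 0<k (ℕ.≤-pred k<1+n))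
  ...   | no ¬eq = inj₁ λ k 0<k k≤1+n → case ℕ.m≤n⇒m<n∨m≡n k≤1+n of λ where
    (inj₁ k<1+n)  → none k 0<k (ℕ.≤-pred k<1+n)
    (inj₂ ≡.refl) → ¬eq

  %≢0⇒≉ε : ∀ {g m} .{{_ : NonZero m}} → m · g ≈ ε → (∀ k → 0 < k → k < m → ¬ k · g ≈ ε) →
           ∀ {k} → k % m ≢ 0 → ¬ k · g ≈ ε
  %≢0⇒≉ε {m = m} mg≈ε first {k} k%m≢0 kg≈ε =
    first (k % m) (ℕ.n≢0⇒n>0 k%m≢0) (m%n<n k m) (trans (sym (·-% mg≈ε k)) kg≈ε)

  -- Subgroups spanned by torsion elements.

  record Torsion : Set (c ⊔ ℓ) where
    field
      generator : Carrier
      order-1   : ℕ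
      torsion   : suc order-1 · generator ≈ ε

  open Torsion

  -- Coefficients are arbitrary naturals, which makes closure under addition immediate. Reducing
  -- them modulo the annihilators of the generators gives the finite list `combinations`, whose
  -- length bounds the size of the subgroup.
  data Span : List Torsion → Carrier → Set (c ⊔ ℓ) where
    nil  : ∀ {x} → x ≈ ε → Span [] x
    cons : ∀ {t ts x y} k → Span ts y → x ≈ k · generator t ∙ y → Span (t ∷ ts) x

  combinations : List Torsion → List Carrier
  combinations []       = ε ∷ []
  combinations (t ∷ ts) =
    cartesianProductWith _∙_ (applyUpTo (_· generator t) (suc (order-1 t))) (combinations ts)

  Span⇒∈combinations : ∀ {ts x} → Span ts x → x ∈ combinations ts
  Span⇒∈combinations (nil x≈ε) = here x≈ε
  Span⇒∈combinations (cons {t} k y∈ x≈) = Membership.∈-resp-≈ setoid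
    (sym (trans x≈ (∙-congʳ (·-% (torsion t) k))))
    (Membership.∈-cartesianProductWith⁺ setoid setoid setoid ∙-cong
      (Membership.∈-applyUpTo⁺ setoid (_· generator t) (m%n<n k (suc (order-1 t)))) (Span⇒∈combinations y∈))

  ∈combinations⇒Span : ∀ ts {x} → x ∈ combinations ts → Span ts x
  ∈combinations⇒Span []       (here x≈ε) = nil x≈ε
  ∈combinations⇒Span (t ∷ ts) x∈
    with _ , y , k·g∈ , y∈ , x≈ ← Membership.∈-cartesianProductWith⁻ setoid setoid setoid _∙_
                                    (applyUpTo (_· generator t) (suc (order-1 t))) (combinations ts) x∈
    with k , _ , ≈k·g ← Membership.∈-applyUpTo⁻ setoid (_· generator t) k·g∈
    = cons k (∈combinations⇒Span ts y∈) (trans x≈ (∙-congʳ ≈k·g))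

  ∙-interchange : ∀ w x y z → (w ∙ x) ∙ (y ∙ z) ≈ (w ∙ y) ∙ (x ∙ z)
  ∙-interchange = CM.solve 4 (λ w x y z → (w CM.⊕ x) CM.⊕ (y CM.⊕ z) CM.⊜ (w CM.⊕ y) CM.⊕ (x CM.⊕ z)) refl

  Span-resp : ∀ {ts} → Span ts Respects _≈_
  Span-resp x≈y (nil x≈ε)      = nil (trans (sym x≈y) x≈ε)
  Span-resp x≈y (cons k z∈ x≈) = cons k z∈ (trans (sym x≈y) x≈)

  Span-weaken : ∀ {t ts x} → Span ts x → Span (t ∷ ts) x
  Span-weaken x∈ = cons 0 x∈ (sym (identityˡ _))

  Span-ε : ∀ {ts} → Span ts ε
  Span-ε {[]}     = nil refl
  Span-ε {_ ∷ ts} = Span-weaken Span-ε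

  Span-generator : ∀ {t ts} → Span (t ∷ ts) (generator t)
  Span-generator = cons 1 Span-ε (trans (sym (×-homo-1 _)) (sym (identityʳ _)))

  Span-∙ : ∀ {ts x y} → Span ts x → Span ts y → Span ts (x ∙ y)
  Span-∙ (nil x≈ε) (nil y≈ε) = nil (trans (∙-cong x≈ε y≈ε) (identityˡ ε))
  Span-∙ (cons {t} j z∈ x≈) (cons k w∈ y≈) = cons (j + k) (Span-∙ z∈ w∈)
    (trans (∙-cong x≈ y≈) (trans (∙-interchange _ _ _ _) (∙-congʳ (sym (×-homo-+ (generator t) j k)))))

  Span-· : ∀ {ts x} k → Span ts x → Span ts (k · x)
  Span-· zero    x∈ = Span-ε
  Span-· (suc k) x∈ = Span-∙ x∈ (Span-· k x∈)

  Span-⁻¹ : ∀ {ts x} → Span ts x → Span ts (x ⁻¹)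
  Span-⁻¹ (nil x≈ε) = nil (trans (⁻¹-cong x≈ε) ε⁻¹≈ε)
  -- With n + 1 annihilating g, the negative of k · g is (k * n) · g.
  Span-⁻¹ {x = x} (cons {t} {y = y} k y∈ x≈) = cons (k * order-1 t) (Span-⁻¹ y∈)
    (sym (inverseʳ-unique x _ (begin
      x ∙ ((k * n) · g ∙ y ⁻¹)               ≈⟨ ∙-congʳ x≈ ⟩
      k · g ∙ y ∙ ((k * n) · g ∙ y ⁻¹)       ≈⟨ ∙-interchange _ _ _ _ ⟩
      k · g ∙ (k * n) · g ∙ (y ∙ y ⁻¹)       ≈⟨ ∙-cong (×-homo-+ g k (k * n)) (sym (inverseʳ y)) ⟨
      (k + k * n) · g ∙ ε                    ≈⟨ identityʳ _ ⟩
      (k + k * n) · g                        ≈⟨ ×-congˡ (ℕ.*-suc k n) ⟨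
      (k * suc n) · g                        ≈⟨ ×-assocˡ g k (suc n) ⟨
      k · suc n · g                          ≈⟨ ×-congʳ k (torsion t) ⟩
      k · ε                                  ≈⟨ ·-ε k ⟩
      ε                                      ∎)))
    where
    open ≈-Reasoning
    n = order-1 t
    g = generator t

  Span-cancelˡ : ∀ {ts x y} → Span ts x → Span ts (x ∙ y) → Span ts y
  Span-cancelˡ {x = x} {y} x∈ xy∈ =
    Span-resp (trans (sym (assoc _ _ _)) (trans (∙-congʳ (inverseˡ x)) (identityˡ y))) (Span-∙ (Span-⁻¹ x∈) xy∈)

  Span-solve : ∀ {ts x y} → Span ts x → x ∙ y ≈ ε → Span ts y
  Span-solve x∈ xy≈ε = Span-cancelˡ x∈ (Span-resp (sym xy≈ε) Span-ε)

  -- Elements outside a proper subgroup.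

  search : ∀ {p} {P : Carrier → Set p} → P Respects _≈_ → (∀ x → Dec (P x)) → (∃[ x ] P x) ⊎ (∀ x → ¬ P x)
  search P-resp P? with Any.any? P? universe
  ... | yes some = let x , _ , Px = find some in inj₁ (x , Px)
  ... | no none  = inj₂ λ x Px → none (Any.map (λ x≈y → P-resp x≈y Px) (∈-universe x))

  from-injective : ∀ {i j} → from i ≈ from j → i ≡ j
  from-injective {i} {j} eq = ≡.trans (≡.sym (strictlyInverseˡ i)) (≡.trans (to-cong eq) (strictlyInverseˡ j))

  ∉-resp : ∀ {xs} → (_∉ xs) Respects _≈_
  ∉-resp = Membership.∉-resp-≈ setoid

  ∃-outside : ∀ xs → length xs < order → ∃[ x ] x ∉ xs
  ∃-outside xs short with search ∉-resp (λ x → ¬? (x ∈? xs))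
  ... | inj₁ outside = outside
  ... | inj₂ covered = contradiction
    (≡.subst (_≤ length xs) (length-tabulate from)
      (⊆⇒length≤ (Unique.tabulate⁺ setoid from-injective) λ {x} _ → decidable-stable (x ∈? xs) (covered x)))
    (ℕ.<⇒≱ short)

  module _ {ts : List Torsion} (A : Quadruple) (as⊆ : All (Span ts) (Quadruple.as A)) where

    open Quadruple A

    private
      sum∈ : ∀ {xs} → All (Span ts) xs → Span ts (sum xs)
      sum∈ []         = Span-ε
      sum∈ (x∈ ∷ xs∈) = Span-∙ x∈ (sum∈ xs∈)

      pairs : ∀ {x} → ¬ Span ts x → ∀ {xs} → All (Span ts) xs → AllPairs (λ q r → ¬ Completes x q r) xs
      pairs x∉ []         = []
      pairs x∉ (q∈ ∷ xs∈) =
        All.map (λ r∈ xqr → x∉ (Span-solve (Span-∙ q∈ r∈) (trans (comm _ _) xqr))) xs∈ ∷ pairs x∉ xs∈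

    -- When the subgroup contains the quadruple, a failure of any other condition of
    -- `quadruple⇒attained` would express x through elements of the subgroup. Only 2x + Σ as ≠ 0 has
    -- to be assumed.
    outside⇒attained : ∀ {x} → ¬ Span ts x → ¬ x ∙ (x ∙ sum as) ≈ ε → Attained group 6
    outside⇒attained {x} x∉ x≉y = quadruple⇒attained A x
      (All.map (λ a∈ x≈a → x∉ (Span-resp (sym x≈a) a∈)) as⊆)
      (All.map (λ a∈ eq → x∉ (Span-solve (Span-∙ (sum∈ as⊆) a∈) (trans (comm _ _) eq))) as⊆)
      x≉y (pairs x∉ as⊆)

    -- If x fails because 2x + Σ as = 0, then x + u does not.
    outside⇒attained′ : ∀ {u x} → Span ts u → ¬ u ∙ u ≈ ε → ¬ Span ts x → Attained group 6
    outside⇒attained′ {u} {x} u∈ 2u≉ε x∉ with x ∙ (x ∙ sum as) ≟ ε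
    ... | no x≉y  = outside⇒attained x∉ x≉y
    ... | yes x≈y = outside⇒attained {u ∙ x} (x∉ ∘ Span-cancelˡ u∈) λ eq → 2u≉ε (begin
      u ∙ u                              ≈⟨ identityʳ _ ⟨
      u ∙ u ∙ ε                          ≈⟨ ∙-congˡ x≈y ⟨
      u ∙ u ∙ (x ∙ (x ∙ sum as))         ≈⟨ CM.solve 3 (λ u x s → (u CM.⊕ u) CM.⊕ (x CM.⊕ (x CM.⊕ s)) CM.⊜
                                             (u CM.⊕ x) CM.⊕ ((u CM.⊕ x) CM.⊕ s)) refl u x (sum as) ⟩
      u ∙ x ∙ (u ∙ x ∙ sum as)           ≈⟨ eq ⟩
      ε                                  ∎)
      where open ≈-Reasoning

  -- Groups with an element of order at least 5.

  largeOrder⇒attained : 9 ≤ order → ∀ {g} → ¬ 3 · g ≈ ε → ¬ 4 · g ≈ ε → Attained group 6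
  largeOrder⇒attained 9≤order {g} 3g≉ε 4g≉ε with ∃-firstVanishing g 14
  -- The set consists of 0, g, 2g, 3g, 4g and -10g.
  ... | inj₁ none = Multiples.attained (λ k → 0 ℕ.<? k ×-dec k ℕ.≤? 14) (λ (0<k , k≤14) → none _ 0<k k≤14)
    is 4 (from-yes (UpTo14.isQuadruple? is)) (from-yes (UpTo14.extends? is 4))
    where is = 0 ∷ 1 ∷ 2 ∷ 3 ∷ []
  ... | inj₂ (m , 0<m , m≤14 , mg≈ε , first) with m ℕ.<? 5 | m ℕ.<? 9
  -- Each of the orders 1, 2, 3, 4 divides 3 or 4.
  ...   | yes m<5 | _ = ⊥-elim (case interval 4 0<m m<5 of λ where
            (zero                 , ≡.refl) → 3g≉ε (trans (×-congʳ 3 (g≈ε mg≈ε)) (·-ε 3))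
            (suc zero             , ≡.refl) → 4g≉ε (trans (sym (×-assocˡ g 2 2)) (trans (×-congʳ 2 mg≈ε) (·-ε 2)))
            (suc (suc zero)       , ≡.refl) → 3g≉ε mg≈ε
            (suc (suc (suc zero)) , ≡.refl) → 4g≉ε mg≈ε)
    where
    g≈ε : 1 · g ≈ ε → g ≈ ε
    g≈ε = trans (sym (×-homo-1 g))
  -- The subgroup ⟨g⟩ has at most 8 elements, so some x lies outside it. The shift u is g itself,
  -- since 2g = 0 would give 4g = 0.
  ...   | no m≮5 | yes m<9 with i , ≡.refl ← interval 4 (ℕ.≮⇒≥ m≮5) m<9 =
    let x , x∉ = ∃-outside (combinations ts)
                   (ℕ.≤-trans (s≤s (ℕ.≤-trans (ℕ.≤-reflexive length≡) (ℕ.≤-pred m<9))) 9≤order)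
    in outside⇒attained′ A (All.map⁺ (All.universal (λ k → Span-· k g∈) quadruple₅₋₈)) g∈
         (λ 2g≈ε → 4g≉ε (trans (CM.solve 1 (λ g → g CM.⊕ (g CM.⊕ (g CM.⊕ (g CM.⊕ CM.id))) CM.⊜
            (g CM.⊕ g) CM.⊕ (g CM.⊕ g)) refl g) (trans (∙-cong 2g≈ε 2g≈ε) (identityˡ ε))))
         (x∉ ∘ Span⇒∈combinations)
    where
    ts : List Torsion
    ts = record { generator = g ; order-1 = 4 + toℕ i ; torsion = mg≈ε } ∷ []
    g∈ : Span ts g
    g∈ = Span-generator
    A = Multiples.quadruple (λ k → ¬? (k % (5 + toℕ i) ℕ.≟ 0)) (λ {k} → %≢0⇒≉ε mg≈ε first {k}) (quadruple₅₋₈-valid i)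
    length≡ : length (combinations ts) ≡ 5 + toℕ i
    length≡ = ≡.trans (length-cartesianProductWith _∙_ (applyUpTo (_· g) (5 + toℕ i)) (ε ∷ []))
      (≡.trans (ℕ.*-identityʳ _) (length-applyUpTo (_· g) (5 + toℕ i)))
  ...   | no m≮5 | no m≮9 with i , ≡.refl ← interval 6 (ℕ.≮⇒≥ m≮9) (s≤s m≤14) =
    Multiples.attained (λ k → ¬? (k % (9 + toℕ i) ℕ.≟ 0)) (λ {k} → %≢0⇒≉ε mg≈ε first {k})
      (proj₁ (quadruple₉₋₁₄ (9 + toℕ i))) (proj₂ (quadruple₉₋₁₄ (9 + toℕ i)))
      (proj₁ (quadruple₉₋₁₄-valid i)) (proj₂ (quadruple₉₋₁₄-valid i))

  -- The quadruple 0, a, b, a + b.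

  module _ {g h : Torsion} where
    private
      a = generator g
      b = generator h

    -- The total 2a + 2b has to avoid all four elements. The hypotheses exclude 0 and a; equality
    -- with b or with a + b would mean 2a + b = 0 or a + b = 0 and put b into ⟨a⟩. The shift u is a.
    pair⇒attained : ¬ a ∙ a ≈ ε → ¬ Span (g ∷ []) b → ¬ a ∙ (b ∙ b) ≈ ε → ¬ (a ∙ b) ∙ (a ∙ b) ≈ ε →
                    ∀ {x} → ¬ Span (h ∷ g ∷ []) x → Attained group 6
    pair⇒attained 2a≉ε b∉ a+2b≉ε 2a+2b≉ε = outside⇒attained′ A
      (Span-ε ∷ a∈ ∷ b∈ ∷ Span-∙ a∈ b∈ ∷ []) a∈ 2a≉ε
      where
      a∈ : Span (h ∷ g ∷ []) a
      a∈ = Span-weaken Span-generator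
      b∈ : Span (h ∷ g ∷ []) b
      b∈ = Span-generator
      a∈⟨a⟩ : Span (g ∷ []) a
      a∈⟨a⟩ = Span-generator
      a≉ε : ¬ a ≈ ε
      a≉ε a≈ε = 2a≉ε (trans (∙-cong a≈ε a≈ε) (identityˡ ε))
      ab≉ε : ¬ a ∙ b ≈ ε
      ab≉ε = b∉ ∘ Span-solve a∈⟨a⟩
      as = ε ∷ a ∷ b ∷ a ∙ b ∷ []
      Σ≈ : sum as ≈ (a ∙ b) ∙ (a ∙ b)
      Σ≈ = CM.solve 2 (λ a b → CM.id CM.⊕ (a CM.⊕ (b CM.⊕ ((a CM.⊕ b) CM.⊕ CM.id))) CM.⊜ (a CM.⊕ b) CM.⊕ (a CM.⊕ b)) refl a b
      Σ≈a : sum as ≈ a ∙ (a ∙ (b ∙ b))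
      Σ≈a = CM.solve 2 (λ a b → CM.id CM.⊕ (a CM.⊕ (b CM.⊕ ((a CM.⊕ b) CM.⊕ CM.id))) CM.⊜ a CM.⊕ (a CM.⊕ (b CM.⊕ b))) refl a b
      Σ≈b : sum as ≈ b ∙ (a ∙ a ∙ b)
      Σ≈b = CM.solve 2 (λ a b → CM.id CM.⊕ (a CM.⊕ (b CM.⊕ ((a CM.⊕ b) CM.⊕ CM.id))) CM.⊜ b CM.⊕ ((a CM.⊕ a) CM.⊕ b)) refl a b
      cancel : ∀ {x y} → x ∙ y ≈ x → y ≈ ε
      cancel {x} {y} xy≈x = ∙-cancelˡ x y ε (trans xy≈x (sym (identityʳ x)))
      A : Quadruple
      A = record
        { as     = as
        ; ∣as∣≡4 = ≡.refl
        ; as!    = (a≉ε ∘ sym ∷ (λ ε≈b → b∉ (Span-resp ε≈b Span-ε)) ∷ ab≉ε ∘ sym ∷ [])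
                 ∷ ((λ a≈b → b∉ (Span-resp a≈b a∈⟨a⟩)) ∷ (λ a≈ab → b∉ (Span-resp (sym (cancel (sym a≈ab))) Span-ε)) ∷ [])
                 ∷ ((λ b≈ab → a≉ε (cancel (trans (comm b a) (sym b≈ab)))) ∷ [])
                 ∷ [] ∷ []
        ; Σas∉as = (λ Σ≈ε → 2a+2b≉ε (trans (sym Σ≈) Σ≈ε))
                 ∷ (λ Σ≈a′ → a+2b≉ε (cancel (trans (sym Σ≈a) Σ≈a′)))
                 ∷ (λ Σ≈b′ → b∉ (Span-solve (Span-∙ a∈⟨a⟩ a∈⟨a⟩) (cancel (trans (sym Σ≈b) Σ≈b′))))
                 ∷ (λ Σ≈ab → ab≉ε (cancel (trans (sym Σ≈) Σ≈ab)))
                 ∷ []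
        }

  -- Groups of exponent 2 and 4.

  outsideSpan : ∀ ts → length (combinations ts) < order → ∃[ x ] ¬ Span ts x
  outsideSpan ts short = let x , x∉ = ∃-outside (combinations ts) short in x , x∉ ∘ Span⇒∈combinations

  -- The elements e₁, e₂, e₃ are independent over the field with two elements, and x lies outside
  -- their span of size at most 8. Shifting x cannot change 2x = 0, so the condition 2x + Σ as ≠ 0
  -- has to come from e₁ + e₂ + e₃ ≠ 0.
  exponent2⇒attained : 9 ≤ order → (∀ x → x ∙ x ≈ ε) → Attained group 6
  exponent2⇒attained 9≤order 2x≈ε =
    let x , x∉ = outsideSpan ts₃ 9≤order in outside⇒attained A as⊆ x∉ λ eq → Σ≉ε (begin
      sum as               ≈⟨ identityˡ _ ⟨
      ε ∙ sum as           ≈⟨ ∙-congʳ (2x≈ε x) ⟨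
      x ∙ x ∙ sum as       ≈⟨ assoc _ _ _ ⟩
      x ∙ (x ∙ sum as)     ≈⟨ eq ⟩
      ε                    ∎)
    where
    open ≈-Reasoning
    involution : Carrier → Torsion
    involution x = record { generator = x ; order-1 = 1 ; torsion = trans (∙-congˡ (identityʳ x)) (2x≈ε x) }
    below : ∀ {n} → n ≤ 9 → n ≤ order
    below n≤9 = ℕ.≤-trans n≤9 9≤order
    -- The constants 2, 3, 5 exceed by one the lengths 1, 2, 4 of the lists of combinations to be
    -- avoided.
    e₁ = proj₁ (outsideSpan [] (below (from-yes (2 ℕ.≤? 9))))
    e₁∉ = proj₂ (outsideSpan [] (below (from-yes (2 ℕ.≤? 9))))
    ts₁ = involution e₁ ∷ []
    e₂ = proj₁ (outsideSpan ts₁ (below (from-yes (3 ℕ.≤? 9))))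
    e₂∉ = proj₂ (outsideSpan ts₁ (below (from-yes (3 ℕ.≤? 9))))
    ts₂ = involution e₂ ∷ ts₁
    e₃ = proj₁ (outsideSpan ts₂ (below (from-yes (5 ℕ.≤? 9))))
    e₃∉ = proj₂ (outsideSpan ts₂ (below (from-yes (5 ℕ.≤? 9))))
    ts₃ = involution e₃ ∷ ts₂
    as = ε ∷ e₁ ∷ e₂ ∷ e₃ ∷ []
    e₁∈ts₁ : Span ts₁ e₁
    e₁∈ts₁ = Span-generator
    e₁∈ts₂ : Span ts₂ e₁
    e₁∈ts₂ = Span-weaken e₁∈ts₁
    e₂∈ts₂ : Span ts₂ e₂
    e₂∈ts₂ = Span-generator
    as⊆ : All (Span ts₃) as
    as⊆ = Span-ε ∷ Span-weaken e₁∈ts₂ ∷ Span-weaken e₂∈ts₂ ∷ Span-generator ∷ []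
    Σ≈ : sum as ≈ e₁ ∙ e₂ ∙ e₃
    Σ≈ = CM.solve 3 (λ a b c → CM.id CM.⊕ (a CM.⊕ (b CM.⊕ (c CM.⊕ CM.id))) CM.⊜ (a CM.⊕ b) CM.⊕ c) refl e₁ e₂ e₃
    Σ≉ε : ¬ sum as ≈ ε
    Σ≉ε Σ≈ε = e₃∉ (Span-solve (Span-∙ e₁∈ts₂ e₂∈ts₂) (trans (sym Σ≈) Σ≈ε))
    ≉-generator : ∀ {ts x y} → Span ts x → ¬ Span ts y → ¬ x ≈ y
    ≉-generator x∈ y∉ x≈y = y∉ (Span-resp x≈y x∈)
    A : Quadruple
    A = record
      { as     = as
      ; ∣as∣≡4 = ≡.refl
      ; as!    = (≉-generator Span-ε e₁∉ ∷ ≉-generator Span-ε e₂∉ ∷ ≉-generator Span-ε e₃∉ ∷ [])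
               ∷ (≉-generator e₁∈ts₁ e₂∉ ∷ ≉-generator e₁∈ts₂ e₃∉ ∷ [])
               ∷ (≉-generator e₂∈ts₂ e₃∉ ∷ []) ∷ [] ∷ []
      ; Σas∉as = Σ≉ε
               ∷ (λ eq → e₃∉ (Span-cancelˡ (Span-∙ e₁∈ts₂ e₂∈ts₂) (Span-resp (trans (sym eq) Σ≈) e₁∈ts₂)))
               ∷ (λ eq → e₃∉ (Span-cancelˡ (Span-∙ e₁∈ts₂ e₂∈ts₂) (Span-resp (trans (sym eq) Σ≈) e₂∈ts₂)))
               ∷ (λ eq → e₂∉ (Span-solve e₁∈ts₁ (∙-cancelʳ e₃ _ _ (trans (sym Σ≈) (trans eq (sym (identityˡ e₃)))))))
               ∷ []
      }

  ·₄ : ∀ x → 4 · x ≈ (x ∙ x) ∙ (x ∙ x)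
  ·₄ = CM.solve 1 (λ x → x CM.⊕ (x CM.⊕ (x CM.⊕ (x CM.⊕ CM.id))) CM.⊜ (x CM.⊕ x) CM.⊕ (x CM.⊕ x)) refl

  -- One of h, a + h, 2h will do. If 2h = 0, take h; if 2h = 2a, then 2(a + h) = 4a = 0. Otherwise
  -- take 2h: its double vanishes, which among the multiples of a holds only for 0 and 2a, and 2h is
  -- neither.
  order4⇒involution : ∀ {t h} → order-1 t ≡ 3 → ¬ generator t ∙ generator t ≈ ε → 4 · h ≈ ε →
                      ¬ Span (t ∷ []) h → ∃[ b ] b ∙ b ≈ ε × ¬ Span (t ∷ []) b
  order4⇒involution {t} {h} ≡.refl 2a≉ε 4h≈ε h∉ with h ∙ h ≟ ε | h ∙ h ≟ generator t ∙ generator t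
  ... | yes 2h≈ε | _ = h , 2h≈ε , h∉
  ... | no _ | yes 2h≈2a = a ∙ h , 2[ah]≈ε , h∉ ∘ Span-cancelˡ Span-generator
    where
    a = generator t
    2[ah]≈ε : (a ∙ h) ∙ (a ∙ h) ≈ ε
    2[ah]≈ε = trans (∙-interchange a h a h) (trans (∙-congˡ 2h≈2a) (trans (sym (·₄ a)) (torsion t)))
  ... | no 2h≉ε | no 2h≉2a = h ∙ h , trans (sym (·₄ h)) 4h≈ε , λ where
      (cons k (nil y≈ε) 2h≈) → let i , i≡k%4 = interval 4 z≤n (m%n<n k 4) in
        multiple i (trans 2h≈ (trans (∙-congˡ y≈ε) (trans (identityʳ _)
          (trans (·-% (torsion t) k) (×-congˡ (≡.sym i≡k%4))))))
    where
    a = generator t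
    odd : 2 · (h ∙ h) ≈ ε
    odd = trans (∙-congˡ (identityʳ _)) (trans (sym (·₄ h)) 4h≈ε)
    multiple : ∀ (i : Fin 4) → ¬ h ∙ h ≈ toℕ i · a
    multiple zero eq = 2h≉ε eq
    multiple (suc zero) eq = 2a≉ε (begin
      a ∙ a             ≈⟨ ∙-congˡ (identityʳ a) ⟨
      2 · a             ≈⟨ ×-congʳ 2 (×-homo-1 a) ⟨
      2 · 1 · a         ≈⟨ ×-congʳ 2 eq ⟨
      2 · (h ∙ h)       ≈⟨ odd ⟩
      ε                 ∎)
      where open ≈-Reasoning
    multiple (suc (suc zero)) eq = 2h≉2a (trans eq (∙-congˡ (identityʳ a)))
    multiple (suc (suc (suc zero))) eq = 2a≉ε (begin
      a ∙ a             ≈⟨ ∙-congˡ (identityʳ a) ⟨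
      2 · a             ≈⟨ ·-% {m = 4} (torsion t) 6 ⟨
      6 · a             ≈⟨ ×-assocˡ a 2 3 ⟨
      2 · 3 · a         ≈⟨ ×-congʳ 2 eq ⟨
      2 · (h ∙ h)       ≈⟨ odd ⟩
      ε                 ∎)
      where open ≈-Reasoning

  -- Choosing b with 2b = 0 keeps the span of a and b within 8 elements, so |G| ≥ 9 leaves room for
  -- x. It also turns a + 2b and 2a + 2b into a and 2a, which are nonzero.
  exponent4⇒attained : 9 ≤ order → (∀ x → 4 · x ≈ ε) → ∀ {a} → ¬ a ∙ a ≈ ε → Attained group 6
  exponent4⇒attained 9≤order 4x≈ε {a} 2a≉ε =
    let h , h∉ = outsideSpan (t ∷ []) (ℕ.≤-trans (from-yes (5 ℕ.≤? 9)) 9≤order)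
        b , 2b≈ε , b∉ = order4⇒involution {t} ≡.refl 2a≉ε (4x≈ε h) h∉
        s = record { generator = b ; order-1 = 1 ; torsion = trans (∙-congˡ (identityʳ b)) 2b≈ε }
        x , x∉ = outsideSpan (s ∷ t ∷ []) 9≤order
    in pair⇒attained {t} {s} 2a≉ε b∉
         (λ eq → 2a≉ε (let a≈ε = trans (sym (identityʳ a)) (trans (∙-congˡ (sym 2b≈ε)) eq)
                       in trans (∙-cong a≈ε a≈ε) (identityˡ ε)))
         (λ eq → 2a≉ε (trans (sym (identityʳ _)) (trans (∙-congˡ (sym 2b≈ε)) (trans (∙-interchange a a b b) eq))))
         x∉
    where
    t : Torsion
    t = record { generator = a ; order-1 = 3 ; torsion = 4x≈ε a }

  -- Groups of exponent 3 and the recognition of C₃².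

  module _ (3x≈ε : ∀ x → 3 · x ≈ ε) where

    private
      order3 : Carrier → Torsion
      order3 x = record { generator = x ; order-1 = 2 ; torsion = 3x≈ε x }

      2x≈ε⇒x≈ε : ∀ {x} → x ∙ x ≈ ε → x ≈ ε
      2x≈ε⇒x≈ε {x} 2x≈ε = begin
        x                 ≈⟨ identityʳ x ⟨
        x ∙ ε             ≈⟨ ∙-congˡ 2x≈ε ⟨
        x ∙ (x ∙ x)       ≈⟨ ∙-congˡ (∙-congˡ (identityʳ x)) ⟨
        3 · x             ≈⟨ 3x≈ε x ⟩
        ε                 ∎
        where open ≈-Reasoning

    -- A coefficient prime to 3 is invertible modulo 3, so k · x in the span would bring x into it.
    multiple∈Span : ∀ {ts x} → ¬ Span ts x → ∀ k → Span ts (k · x) → k % 3 ≡ 0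
    multiple∈Span {ts} {x} x∉ k kx∈ =
      let i , i≡k%3 = interval 3 z≤n (m%n<n k 3) in ≡.trans (≡.sym i≡k%3)
        (residue i (Span-resp (trans (·-% (3x≈ε x) k) (×-congˡ (≡.sym i≡k%3))) kx∈))
      where
      residue : ∀ (i : Fin 3) → Span ts (toℕ i · x) → toℕ i ≡ 0
      residue zero             _  = ≡.refl
      residue (suc zero)       x∈ = contradiction (Span-resp (identityʳ x) x∈) x∉
      residue (suc (suc zero)) x∈ = contradiction (Span-solve x∈ (trans (comm _ x) (3x≈ε x))) x∉

    -- Modulo 3, i + 2j is i - j, written without subtraction.
    +-double%3≡0⇒≡ : ∀ (i j : Fin 3) → (toℕ i + (toℕ j + toℕ j)) % 3 ≡ 0 → i ≡ j
    +-double%3≡0⇒≡ = from-yes (Fin.all? {n = 3} λ i → Fin.all? {n = 3} λ j →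
      ((toℕ i + (toℕ j + toℕ j)) % 3 ℕ.≟ 0) →-dec (i Fin.≟ j))

    module _ {a b : Carrier} (a≉ε : ¬ a ≈ ε) (b∉⟨a⟩ : ¬ Span (order3 a ∷ []) b)
             (spanned : ∀ x → Span (order3 b ∷ order3 a ∷ []) x) where

      private
        module C₃² = AbelianGroup C₃²

      combination : C₃².Carrier → Carrier
      combination (i , j) = toℕ i · a ∙ toℕ j · b

      ·-mod : ∀ x k → toℕ (k mod 3) · x ≈ k · x
      ·-mod x k = trans (×-congˡ (Fin.toℕ-fromℕ< (m%n<n k 3))) (sym (·-% (3x≈ε x) k))

      coordinates : ∀ x → ∃[ p ] x ≈ combination p
      coordinates x with cons k (cons l (nil z≈ε) y≈) x≈ ← spanned x =
        (l mod 3 , k mod 3) , (begin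
          x                                           ≈⟨ x≈ ⟩
          k · b ∙ _                                   ≈⟨ ∙-congˡ (trans y≈ (trans (∙-congˡ z≈ε) (identityʳ _))) ⟩
          k · b ∙ l · a                               ≈⟨ comm _ _ ⟩
          l · a ∙ k · b                               ≈⟨ ∙-cong (·-mod a l) (·-mod b k) ⟨
          combination (l mod 3 , k mod 3)             ∎)
        where open ≈-Reasoning

      combination-homo : ∀ p q → combination (p C₃².∙ q) ≈ combination p ∙ combination q
      combination-homo (i , j) (k , l) = begin
        toℕ ((toℕ i + toℕ k) mod 3) · a ∙ toℕ ((toℕ j + toℕ l) mod 3) · b  ≈⟨ ∙-cong (·-mod a (toℕ i + toℕ k)) (·-mod b (toℕ j + toℕ l)) ⟩
        (toℕ i + toℕ k) · a ∙ (toℕ j + toℕ l) · b                          ≈⟨ ∙-cong (×-homo-+ a (toℕ i) _) (×-homo-+ b (toℕ j) _) ⟩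
        (toℕ i · a ∙ toℕ k · a) ∙ (toℕ j · b ∙ toℕ l · b)                  ≈⟨ ∙-interchange _ _ _ _ ⟩
        combination (i , j) ∙ combination (k , l)                          ∎
        where open ≈-Reasoning

      combination-cong : ∀ {p q} → p C₃².≈ q → combination p ≈ combination q
      combination-cong (≡.refl , ≡.refl) = refl

      +-double : ∀ {x} i j k → i · x ≈ k ∙ j · x → (i + (j + j)) · x ≈ k
      +-double {x} i j k eq = begin
        (i + (j + j)) · x                    ≈⟨ trans (×-homo-+ x i (j + j)) (∙-congˡ (×-homo-+ x j j)) ⟩
        i · x ∙ (j · x ∙ j · x)              ≈⟨ ∙-congʳ eq ⟩
        k ∙ j · x ∙ (j · x ∙ j · x)          ≈⟨ CM.solve 2 (λ k y → (k CM.⊕ y) CM.⊕ (y CM.⊕ y) CM.⊜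
                                                  k CM.⊕ (y CM.⊕ (y CM.⊕ (y CM.⊕ CM.id)))) refl k (j · x) ⟩
        k ∙ 3 · j · x                        ≈⟨ ∙-congˡ (3x≈ε (j · x)) ⟩
        k ∙ ε                                ≈⟨ identityʳ k ⟩
        k                                    ∎
        where open ≈-Reasoning

      -- Modulo ⟨a⟩ only the multiples of b remain, so b ∉ ⟨a⟩ gives j = l. After cancelling them,
      -- the same argument over the trivial subgroup `Span []` gives i = k from a ≠ 0.
      combination-injective : ∀ {p q} → combination p ≈ combination q → p C₃².≈ q
      combination-injective {i , j} {k , l} eq = i≡k j≡l , j≡l
        where
        open ≈-Reasoning
        ⟨a⟩ = order3 a ∷ []
        a∈ : ∀ n → Span ⟨a⟩ (n · a)
        a∈ n = Span-· n Span-generator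
        jb≈ : toℕ j · b ≈ ((toℕ i · a) ⁻¹ ∙ toℕ k · a) ∙ toℕ l · b
        jb≈ = begin
          toℕ j · b                                              ≈⟨ identityˡ _ ⟨
          ε ∙ toℕ j · b                                          ≈⟨ ∙-congʳ (inverseˡ (toℕ i · a)) ⟨
          (toℕ i · a) ⁻¹ ∙ toℕ i · a ∙ toℕ j · b                 ≈⟨ assoc _ _ _ ⟩
          (toℕ i · a) ⁻¹ ∙ (toℕ i · a ∙ toℕ j · b)               ≈⟨ ∙-congˡ eq ⟩
          (toℕ i · a) ⁻¹ ∙ (toℕ k · a ∙ toℕ l · b)               ≈⟨ assoc _ _ _ ⟨
          (toℕ i · a) ⁻¹ ∙ toℕ k · a ∙ toℕ l · b                 ∎
        j≡l : j ≡ l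
        j≡l = +-double%3≡0⇒≡ j l (multiple∈Span b∉⟨a⟩ (toℕ j + (toℕ l + toℕ l))
          (Span-resp (sym (+-double (toℕ j) (toℕ l) _ jb≈)) (Span-∙ (Span-⁻¹ (a∈ (toℕ i))) (a∈ (toℕ k)))))
        i≡k : j ≡ l → i ≡ k
        i≡k ≡.refl = +-double%3≡0⇒≡ i k (multiple∈Span {[]} (λ where (nil a≈ε) → a≉ε a≈ε)
          (toℕ i + (toℕ k + toℕ k))
          (nil (+-double (toℕ i) (toℕ k) ε (trans (∙-cancelʳ (toℕ j · b) _ _ eq) (sym (identityˡ _))))))

      -- The coordinates `f` are read off from the proofs that `spanned` supplies. That they respect
      -- equality and the group structure follows from their uniqueness, by `combination-injective`.
      ≅C₃² : group ≅ C₃²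
      ≅C₃² = f , record
        { isGroupMonomorphism = record
          { isGroupHomomorphism = record
            { isMonoidHomomorphism = record
              { isMagmaHomomorphism = record
                { isRelHomomorphism = record { cong = f-cong }
                ; homo = λ x y → f-unique (trans (∙-cong (f-section x) (f-section y)) (sym (combination-homo (f x) (f y))))
                }
              ; ε-homo = f-unique (sym (identityˡ ε))
              }
            ; ⁻¹-homo = λ x → f-unique (sym (inverseˡ-unique _ x (begin
                combination (f x C₃².⁻¹) ∙ x                    ≈⟨ ∙-congˡ (f-section x) ⟩
                combination (f x C₃².⁻¹) ∙ combination (f x)    ≈⟨ combination-homo (f x C₃².⁻¹) (f x) ⟨
                combination (f x C₃².⁻¹ C₃².∙ f x)              ≈⟨ combination-cong (C₃².inverseˡ (f x)) ⟩
                ε ∙ ε                                           ≈⟨ identityˡ ε ⟩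
                ε                                               ∎)))
            }
          ; injective = λ {x} {y} fx≈fy → trans (f-section x) (trans (combination-cong fx≈fy) (sym (f-section y)))
          }
        ; surjective = λ p → combination p , λ z≈ → f-unique z≈
        }
        where
        open ≈-Reasoning
        f : Carrier → C₃².Carrier
        f x = proj₁ (coordinates x)
        f-section : ∀ x → x ≈ combination (f x)
        f-section x = proj₂ (coordinates x)
        f-unique : ∀ {x p} → x ≈ combination p → f x C₃².≈ p
        f-unique {x} x≈ = combination-injective (trans (sym (f-section x)) x≈)
        f-cong : ∀ {x y} → x ≈ y → f x C₃².≈ f y
        f-cong {x} {y} x≈y = f-unique (trans x≈y (f-section y))

    -- Either some x lies outside ⟨a, b⟩, or a and b form a basis and G is C₃². In the first case a
    -- + 2b = 0 = b + 2b would give a = b, and 2a + 2b = 0 would give a + b = 0.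
    exponent3⇒attained : 9 ≤ order → ¬ (group ≅ C₃²) → ∀ {a} → ¬ a ≈ ε → Attained group 6
    exponent3⇒attained 9≤order ≇C₃² {a} a≉ε
      with b , b∉ ← outsideSpan (order3 a ∷ []) (ℕ.≤-trans (from-yes (4 ℕ.≤? 9)) 9≤order)
      with search ∉-resp (λ x → ¬? (x ∈? combinations (order3 b ∷ order3 a ∷ [])))
    ... | inj₁ (x , x∉) = pair⇒attained {order3 a} {order3 b}
      (a≉ε ∘ 2x≈ε⇒x≈ε) b∉
      (λ a+2b≈ε → b∉ (Span-resp (∙-cancelʳ (b ∙ b) a b (trans a+2b≈ε
        (sym (trans (∙-congˡ (∙-congˡ (sym (identityʳ b)))) (3x≈ε b))))) Span-generator))
      (b∉ ∘ Span-solve Span-generator ∘ 2x≈ε⇒x≈ε)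
      (x∉ ∘ Span⇒∈combinations)
    ... | inj₂ covered = contradiction
      (≅C₃² a≉ε b∉ λ x → ∈combinations⇒Span _ (decidable-stable (x ∈? _) (covered x))) ≇C₃²

  -- Reduction to the exponents 2, 3 and 4.

  attained₆ : 9 ≤ order → ¬ (group ≅ C₃²) → Attained group 6
  attained₆ 9≤order ≇C₃²
    with search (λ x≈y (3x≉ε , 4x≉ε) → 3x≉ε ∘ trans (×-congʳ 3 x≈y) , 4x≉ε ∘ trans (×-congʳ 4 x≈y))
                (λ x → ¬? (3 · x ≟ ε) ×-dec ¬? (4 · x ≟ ε))
       | search (λ x≈y 2x≉ε → 2x≉ε ∘ trans (∙-cong x≈y x≈y)) (λ x → ¬? (x ∙ x ≟ ε))
  ... | inj₁ (g , 3g≉ε , 4g≉ε) | _ = largeOrder⇒attained 9≤order 3g≉ε 4g≉ε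
  ... | inj₂ _ | inj₂ 2x≈ε = exponent2⇒attained 9≤order (λ x → decidable-stable (x ∙ x ≟ ε) (2x≈ε x))
  ... | inj₂ 3∨4 | inj₁ (a , 2a≉ε) with 3 · a ≟ ε
  ...   | yes 3a≈ε = exponent3⇒attained
      -- If 3x ≠ 0, then 4x = 0, and neither 3 nor 4 annihilates a + x: 3(a + x) = 3x and 4(a + x) =
      -- 4a = a.
      (λ x → decidable-stable (3 · x ≟ ε) λ 3x≉ε → 3∨4 (a ∙ x)
        ( (λ eq → 3x≉ε (trans (sym (trans (distrib 3 x) (trans (∙-congʳ 3a≈ε) (identityˡ _)))) eq))
        , (λ eq → a≉ε (trans (sym (trans (distrib 4 x)
            (trans (∙-cong (trans (∙-congˡ 3a≈ε) (identityʳ a)) (3x≉ε⇒4x≈ε 3x≉ε)) (identityʳ a)))) eq)) ))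
      9≤order ≇C₃² a≉ε
    where
    distrib : ∀ n x → n · (a ∙ x) ≈ n · a ∙ n · x
    distrib n x = ×-distrib-+ a x n
    a≉ε : ¬ a ≈ ε
    a≉ε a≈ε = 2a≉ε (trans (∙-cong a≈ε a≈ε) (identityˡ ε))
    3x≉ε⇒4x≈ε : ∀ {x} → ¬ 3 · x ≈ ε → 4 · x ≈ ε
    3x≉ε⇒4x≈ε {x} 3x≉ε = decidable-stable (4 · x ≟ ε) λ 4x≉ε → 3∨4 x (3x≉ε , 4x≉ε)
  ...   | no 3a≉ε = exponent4⇒attained 9≤order
      -- Here 4a = 0. If 4x ≠ 0, then 3x = 0, and again a + x is annihilated by neither: 3(a + x) =
      -- 3a and 4(a + x) = 4x.
      (λ x → decidable-stable (4 · x ≟ ε) λ 4x≉ε → 3∨4 (a ∙ x)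
        ( (λ eq → 3a≉ε (trans (sym (trans (distrib 3 x) (trans (∙-congˡ (4x≉ε⇒3x≈ε 4x≉ε)) (identityʳ _)))) eq))
        , (λ eq → 4x≉ε (trans (sym (trans (distrib 4 x) (trans (∙-congʳ 4a≈ε) (identityˡ _)))) eq)) ))
      2a≉ε
    where
    distrib : ∀ n x → n · (a ∙ x) ≈ n · a ∙ n · x
    distrib n x = ×-distrib-+ a x n
    4a≈ε : 4 · a ≈ ε
    4a≈ε = decidable-stable (4 · a ≟ ε) λ 4a≉ε → 3∨4 a (3a≉ε , 4a≉ε)
    4x≉ε⇒3x≈ε : ∀ {x} → ¬ 4 · x ≈ ε → 3 · x ≈ ε
    4x≉ε⇒3x≈ε {x} 4x≉ε = decidable-stable (3 · x ≟ ε) λ 3x≉ε → 3∨4 x (3x≉ε , 4x≉ε)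

  -- Order and exponent of C₃².

  ≅C₃²⇒order≤9 : group ≅ C₃² → order ≤ 9
  ≅C₃²⇒order≤9 (f , iso) = Fin.injective⇒≤ {f = λ i → uncurry combine (f (from i))} λ {i} {j} eq →
    from-injective (IsGroupIsomorphism.injective iso (Fin.combine-injective _ _ _ _ eq))
    where open GroupMorphisms rawGroup (AbelianGroup.rawGroup C₃²)

  ≅C₃²⇒exponent3 : group ≅ C₃² → Exponent3
  ≅C₃²⇒exponent3 (f , iso) x = injective (C₃².trans (∙-homo x (x ∙ x)) (C₃².trans (C₃².∙-congˡ {x = f x} (∙-homo x x))
    (C₃².trans (tripled (proj₁ (f x)) , tripled (proj₂ (f x))) (C₃².sym ε-homo))))
    where
    open GroupMorphisms rawGroup (AbelianGroup.rawGroup C₃²)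
    open IsGroupIsomorphism iso
    module C₃² = AbelianGroup C₃²
    module C₃ = AbelianGroup (C 3)
    tripled : ∀ i → i C₃.∙ (i C₃.∙ i) ≡ C₃.ε
    tripled = from-yes (Fin.all? {n = 3} λ i → i C₃.∙ (i C₃.∙ i) Fin.≟ C₃.ε)

theorem1p1 : ∀ {c ℓ} (G : FiniteAbelianGroup c ℓ) →
    let open FiniteAbelianGroup G in
    ((order ≤ 8) ⊎ (group ≅ C₃²) → μ⟨ G ⟩≡ ∞)
    × (¬ ((order ≤ 8) ⊎ (group ≅ C₃²)) → μ⟨ G ⟩≡ [ 6 ])
theorem1p1 G =
    (λ where
      (inj₁ order≤8) → small⇒μ≡∞ G (inj₁ order≤8)
      (inj₂ ≅C₃²)    → small⇒μ≡∞ G (inj₂ (≅C₃²⇒order≤9 G ≅C₃² , ≅C₃²⇒exponent3 G ≅C₃²)))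
  , (λ large → attained₆ G (ℕ.≰⇒> (large ∘ inj₁)) (large ∘ inj₂) , attained⇒6≤ G)
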